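{- There is a single-pass streaming algorithm for \textsc{sink-find-t} that uses $O(\mathrm{polylog}\, n)$ space and has failure probability at most $1/3$, under the assumption that the data stream is randomly ordered.
   Context: Input: an $n$-vertex tournament whose edges are presented as a stream in a uniformly random order. \textsc{sink-find-t}: under the promise that the input is an acyclic tournament, output a sink (vertex with no outgoing edges). The failure probability is over the algorithm's randomness and the stream order. -}

module Defs where

open import Data.Nat using (ℕ; zero; suc; _+_; _*_; _^_; _≤_)
open import Data.Nat.Logarithm using (⌊log₂_⌋)
open import Data.Fin using (Fin; zero; suc; inject₁; fromℕ)
open import Data.Fin.Properties using (_≟_)
open import Data.Bool using (Bool; true; false; not; _∧_; _∨_; if_then_else_)
open import Data.List using (List; []; _∷_; [_]; map; concatMap; length; filterᵇ; allFin)
open import Data.Bool.ListAction using (and)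
open import Data.Nat.ListAction using (sum)
open import Data.Product using (_×_; _,_; Σ; ∃)
open import Data.Sum using (_⊎_)
open import Data.Empty using (⊥)
open import Relation.Nullary using (does; ¬_)
open import Relation.Binary.PropositionalEquality using (_≡_; _≢_)

all : {A : Set} → (A → Bool) → List A → Bool
all p xs = and (map p xs)

-- Tournaments on vertex set Fin n.  `beats u v ≡ true` means the edge
-- between u and v is directed u → v.

Digraph : ℕ → Set
Digraph n = Fin n → Fin n → Bool

record IsTournament {n : ℕ} (beats : Digraph n) : Set where
  field
    irrefl   : ∀ u → beats u u ≡ false
    total    : ∀ u v → u ≢ v → (beats u v ≡ true) ⊎ (beats v u ≡ true)
    asym     : ∀ u v → beats u v ≡ true → beats v u ≡ false

Acyclic : {n : ℕ} → Digraph n → Set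
Acyclic {n} beats =
  ∀ (k : ℕ) (w : Fin (suc k) → Fin n) →
    (∀ (i : Fin k) → beats (w (inject₁ i)) (w (suc i)) ≡ true) →
    beats (w (fromℕ k)) (w zero) ≡ true → ⊥

isSink : {n : ℕ} → Digraph n → Fin n → Bool
isSink {n} beats v = all (λ u → not (beats v u)) (allFin n)

Edge : ℕ → Set
Edge n = Fin n × Fin n

allPairs : (n : ℕ) → List (Edge n)
allPairs n = concatMap (λ u → map (λ v → (u , v)) (allFin n)) (allFin n)

edgeCount : {n : ℕ} → Digraph n → ℕ
edgeCount {n} beats = length (filterᵇ (λ e → beats (Data.Product.proj₁ e) (Data.Product.proj₂ e)) (allPairs n))

funs : {A : Set} (m : ℕ) → List A → List (Fin m → A)
funs zero    xs = [ (λ ()) ]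
funs (suc m) xs = concatMap (λ x → map (λ f → cons x f) (funs m xs)) xs
  where
  cons : _ → (Fin _ → _) → Fin (suc _) → _
  cons x f zero    = x
  cons x f (suc i) = f i

eqEdge : {n : ℕ} → Edge n → Edge n → Bool
eqEdge (a , b) (c , d) = does (a ≟ c) ∧ does (b ≟ d)

-- `s : Fin m → Edge n` (with m = |E(T)|) is an ordering of the edge set
-- of T: every entry is an edge of T and entries are pairwise distinct
-- (hence a bijection Fin m → E(T)).
isStreamOrder : {n m : ℕ} → Digraph n → (Fin m → Edge n) → Bool
isStreamOrder {n} {m} beats s =
  all (λ t → beats (Data.Product.proj₁ (s t)) (Data.Product.proj₂ (s t))) (allFin m) ∧
  all (λ t → all (λ t' → not (eqEdge (s t) (s t')) ∨ does (t ≟ t')) (allFin m)) (allFin m)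

-- All random orders of the edge stream of T (uniform distribution = this list).
streamOrders : {n : ℕ} (T : Digraph n) → List (Fin (edgeCount T) → Edge n)
streamOrders {n} T = filterᵇ (λ s → isStreamOrder T s) (funs (edgeCount T) (allPairs n))

-- Single-pass streaming algorithms on n-vertex inputs.
-- Memory: `space` bits, i.e. 2 ^ space states.  At every stream step the
-- algorithm receives a fresh independent uniform random value in
-- Fin (suc coins) (private randomness generated on the fly).

record StreamAlg (n : ℕ) : Set where
  field
    space : ℕ
    coins : ℕ
    init  : Fin (2 ^ space)
    step  : Fin (suc coins) → Edge n → Fin (2 ^ space) → Fin (2 ^ space)
    out   : Fin (2 ^ space) → Fin n

open StreamAlg public

run : {n : ℕ} (A : StreamAlg n) (m : ℕ) → (Fin m → Edge n) → (Fin m → Fin (suc (coins A))) →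
      Fin (2 ^ space A) → Fin (2 ^ space A)
run A zero    s ρ q = q
run A (suc m) s ρ q = run A m (λ t → s (suc t)) (λ t → ρ (suc t)) (step A (ρ zero) (s zero) q)

output : {n m : ℕ} (A : StreamAlg n) → (Fin m → Edge n) → (Fin m → Fin (suc (coins A))) → Fin n
output {n} {m} A s ρ = out A (run A m s ρ (init A))

coinSeqs : {n : ℕ} (A : StreamAlg n) (m : ℕ) → List (Fin m → Fin (suc (coins A)))
coinSeqs A m = funs m (allFin (suc (coins A)))

failures : {n : ℕ} (A : StreamAlg n) (T : Digraph n) → ℕ
failures A T =
  sum (map (λ s → length (filterᵇ (λ ρ → not (isSink T (output A s ρ)))
                                  (coinSeqs A (edgeCount T))))
           (streamOrders T))

outcomes : {n : ℕ} (A : StreamAlg n) (T : Digraph n) → ℕ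
outcomes A T = length (streamOrders T) * length (coinSeqs A (edgeCount T))

PolylogSpace : ((n : ℕ) → StreamAlg (suc n)) → Set
PolylogSpace A = ∃ λ (c : ℕ) → ∃ λ (k : ℕ) →
  ∀ n → space (A n) ≤ c * (suc ⌊log₂ (suc n) ⌋) ^ k

{-# OPTIONS --safe #-}
module Submission where

-- The algorithm remembers one vertex, initially an arbitrary one, and moves along every arriving edge
-- that leaves it.  Edges below the current vertex are independent of the walk so far, so the next
-- vertex is uniform among those of lower rank, unless all out-edges of the current one have passed.
-- By induction on the rank r ≥ 1, a walk at a vertex of rank r with a fraction x of the stream to come
-- succeeds with probability at least 2(r² + r + 1) / 3r(r + 1) * x.  For the step, a random order of
-- all edges is a shuffle of an order of the out-edges of the vertex with an order of the others;
-- the first out-edge after the current time decides where the walk goes on in the latter order.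

open import Defs
open import Data.Nat
  using (ℕ; zero; suc; _+_; _*_; _∸_; _^_; _≤_; _<_; z≤n; s≤s; _!; NonZero; _<?_)
open import Data.Nat.Properties hiding (_≟_)
open import Data.Nat.Combinatorics using (_C_; nCk+nC[k+1]≡[n+1]C[k+1]; nCn≡1; nC1≡n)
open import Data.Nat.Combinatorics.Specification using (k>n⇒nCk≡0)
open import Data.Nat.ListAction using (sum)
open import Data.Nat.ListAction.Properties using (sum-++; sum-↭)
open import Data.Nat.Logarithm using (⌊log₂_⌋; ⌊log₂⌋-mono-≤; ⌊log₂[2^n]⌋≡n)
open import Data.Nat.Tactic.RingSolver using (solve-∀)
open import Data.Bool using (Bool; true; false; if_then_else_; not; _∧_; _∨_; T?)
open import Data.Bool.Properties using (T-≡; ∨-identityʳ)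
open import Data.Empty using (⊥-elim)
open import Data.Fin using (Fin; zero; suc; toℕ; fromℕ<; inject≤)
open import Data.Fin.Properties using (_≟_; toℕ<n; toℕ-inject≤; fromℕ<-toℕ; fromℕ<-cong)
import Data.Fin.Properties as Fin
open import Data.List
  using (List; []; _∷_; [_]; _++_; map; concatMap; length; drop; downFrom; filter; filterᵇ;
         allFin; tabulate; cartesianProduct)
open import Data.List.Properties
  using (map-++; map-∘; length-map; length-++; drop-drop; length-drop; filter-all; filter-none; length-filter)
open import Data.List.Membership.Propositional using (_∈_)
open import Data.List.Membership.Propositional.Properties
  using (∈-map⁺; ∈-map⁻; ∈-++⁻; ∈-concat⁻′; ∈-downFrom⁻; ∈-filter⁺; ∈-filter⁻; ∈-allFin;
         ∈-cartesianProduct⁺)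
open import Data.List.Membership.Propositional.Properties.WithK using (unique∧set⇒bag)
open import Data.List.Relation.Binary.BagAndSetEquality using (∼bag⇒↭)
open import Data.List.Relation.Binary.Permutation.Propositional
  using (_↭_; ↭-refl; ↭-sym; ↭-trans; prep; swap; refl; trans)
open import Data.List.Relation.Binary.Permutation.Propositional.Properties
  using (↭-length; map⁺; shift; ++⁺ʳ; All-resp-↭; ∈-resp-↭)
open import Data.List.Relation.Unary.All as All using (All; []; _∷_)
import Data.List.Relation.Unary.All.Properties as All
open import Data.List.Relation.Unary.AllPairs as AllPairs using (AllPairs; []; _∷_)
open import Data.List.Relation.Unary.Any using (here; there)
open import Data.List.Relation.Unary.Unique.Propositional using (Unique)
import Data.List.Relation.Unary.Unique.Propositional.Properties as Unique
open import Data.Product using (Σ; ∃; _×_; _,_; proj₁; proj₂; uncurry)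
open import Data.Product.Properties using (,-injectiveʳ)
open import Data.Sum using (inj₁; inj₂)
open import Data.Unit using (⊤; tt)
open import Data.Vec using (lookup; []; _∷_)
open import Function using (_∘_; const; id; mk⇔; Equivalence)
open import Relation.Binary.Definitions using (DecidableEquality)
open import Relation.Binary.PropositionalEquality as ≡
  using (_≡_; _≢_; cong; cong₂; sym; subst; module ≡-Reasoning)
open import Relation.Nullary using (¬_; does; yes; no; contradiction)
open import Relation.Nullary.Decidable using (dec-true; dec-false; ¬?; map′)

-- The constant is 2/3 (1 + 1/(r(r + 1))): it is 1 at r = 1, stays above 2/3, and its partial sums
-- telescope, so the average over the lower ranks has a closed form. Put into the recursion, that
-- average gives a function of the elapsed time t that vanishes at the end of the stream, equals (2r
-- + 1)/3r at t = 0 and lies above its chord; this is why a bound linear in x reproduces itself. The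
-- surplus (r - 1)/3r(r + 1) at t = 0 is given away to keep the closed form. The obstacle is
-- conditioning: the position of the walk depends on the edges already seen. Nothing is conditioned
-- on here. Orders are counted, and the induction claim concerns every edge set U in which the
-- vertices from the current one downwards have exactly their proper out-edges; U may contain other
-- edges as well. Deleting the out-edges of the current vertex leaves a set W that satisfies the
-- claim's hypothesis for all lower vertices, and the claim is used for W at the time when j edges
-- of W are still to come, with j depending on the shuffle only. Success probabilities become
-- natural numbers with cleared denominators, and subtracted terms stand on the other side.

private variable
  A B : Set

-- Sums over permutations and shuffles

∑ : List A → (A → ℕ) → ℕ
∑ xs f = sum (map f xs)

∑-cong-∈ : ∀ (xs : List A) {f g} → (∀ {x} → x ∈ xs → f x ≡ g x) → ∑ xs f ≡ ∑ xs g
∑-cong-∈ []       h = ≡.refl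
∑-cong-∈ (x ∷ xs) h = cong₂ _+_ (h (here ≡.refl)) (∑-cong-∈ xs (h ∘ there))

∑-cong : ∀ (xs : List A) {f g} → (∀ x → f x ≡ g x) → ∑ xs f ≡ ∑ xs g
∑-cong xs h = ∑-cong-∈ xs (λ {x} _ → h x)

∑-mono-∈ : ∀ (xs : List A) {f g} → (∀ {x} → x ∈ xs → f x ≤ g x) → ∑ xs f ≤ ∑ xs g
∑-mono-∈ []       h = z≤n
∑-mono-∈ (x ∷ xs) h = +-mono-≤ (h (here ≡.refl)) (∑-mono-∈ xs (h ∘ there))

∑-++ : ∀ (xs ys : List A) f → ∑ (xs ++ ys) f ≡ ∑ xs f + ∑ ys f
∑-++ xs ys f = ≡.trans (cong sum (map-++ f xs ys)) (sum-++ (map f xs) (map f ys))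

∑-map : ∀ (h : A → B) xs f → ∑ (map h xs) f ≡ ∑ xs (f ∘ h)
∑-map h xs f = cong sum (sym (map-∘ xs))

∑-concatMap : ∀ (h : A → List B) xs f → ∑ (concatMap h xs) f ≡ ∑ xs (λ x → ∑ (h x) f)
∑-concatMap h []       f = ≡.refl
∑-concatMap h (x ∷ xs) f =
  ≡.trans (∑-++ (h x) _ f) (cong (∑ (h x) f +_) (∑-concatMap h xs f))

∑-+ : ∀ (xs : List A) f g → ∑ xs (λ x → f x + g x) ≡ ∑ xs f + ∑ xs g
∑-+ []       f g = ≡.refl
∑-+ (x ∷ xs) f g = ≡.trans (cong (f x + g x +_) (∑-+ xs f g)) (interchange (f x) (g x) _ _)
  where
  interchange : ∀ a b c d → a + b + (c + d) ≡ a + c + (b + d)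
  interchange = solve-∀

∑-*ˡ : ∀ c (xs : List A) f → ∑ xs (λ x → c * f x) ≡ c * ∑ xs f
∑-*ˡ c []       f = sym (*-zeroʳ c)
∑-*ˡ c (x ∷ xs) f = ≡.trans (cong (c * f x +_) (∑-*ˡ c xs f)) (sym (*-distribˡ-+ c (f x) _))

∑-const : ∀ (xs : List A) c → ∑ xs (const c) ≡ length xs * c
∑-const []       c = ≡.refl
∑-const (x ∷ xs) c = cong (c +_) (∑-const xs c)

∑-zero : ∀ (xs : List A) → ∑ xs (const 0) ≡ 0
∑-zero xs = ≡.trans (∑-const xs 0) (*-zeroʳ (length xs))

∑-swap : ∀ (xs : List A) (ys : List B) (f : A → B → ℕ) →
         ∑ xs (λ x → ∑ ys (f x)) ≡ ∑ ys (λ y → ∑ xs (λ x → f x y))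
∑-swap []       ys f = sym (∑-zero ys)
∑-swap (x ∷ xs) ys f =
  ≡.trans (cong (∑ ys (f x) +_) (∑-swap xs ys f)) (sym (∑-+ ys (f x) _))

∑-↭ : ∀ {xs ys : List A} f → xs ↭ ys → ∑ xs f ≡ ∑ ys f
∑-↭ f p = sum-↭ (map⁺ f p)

inserts : A → List A → List (List A)
inserts x []      = [ [ x ] ]
inserts x (y ∷ σ) = (x ∷ y ∷ σ) ∷ map (y ∷_) (inserts x σ)

perms : List A → List (List A)
perms []      = [ [] ]
perms (x ∷ U) = concatMap (inserts x) (perms U)

shuffles : List A → List A → List (List A)
shuffles []      ω       = [ ω ]
shuffles (z ∷ ζ) []      = [ z ∷ ζ ]
shuffles (z ∷ ζ) (w ∷ ω) = map (z ∷_) (shuffles ζ (w ∷ ω)) ++ map (w ∷_) (shuffles (z ∷ ζ) ω)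

∑-inserts-∷ : ∀ (x y : A) σ f →
  ∑ (inserts x (y ∷ σ)) f ≡ f (x ∷ y ∷ σ) + ∑ (inserts x σ) (f ∘ (y ∷_))
∑-inserts-∷ x y σ f = cong (f (x ∷ y ∷ σ) +_) (∑-map (y ∷_) (inserts x σ) f)

∑-perms-∷ : ∀ (x : A) U f → ∑ (perms (x ∷ U)) f ≡ ∑ (perms U) (λ σ → ∑ (inserts x σ) f)
∑-perms-∷ x U f = ∑-concatMap (inserts x) (perms U) f

∑-shuffles-∷ : ∀ (z w : A) ζ ω f →
  ∑ (shuffles (z ∷ ζ) (w ∷ ω)) f ≡
  ∑ (shuffles ζ (w ∷ ω)) (f ∘ (z ∷_)) + ∑ (shuffles (z ∷ ζ) ω) (f ∘ (w ∷_))
∑-shuffles-∷ z w ζ ω f = ≡.trans (∑-++ (map (z ∷_) (shuffles ζ (w ∷ ω))) _ f)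
  (cong₂ _+_ (∑-map (z ∷_) (shuffles ζ (w ∷ ω)) f) (∑-map (w ∷_) (shuffles (z ∷ ζ) ω) f))

∑-shuffles-[] : ∀ (ζ : List A) f → ∑ (shuffles ζ []) f ≡ f ζ
∑-shuffles-[] []      f = +-identityʳ _
∑-shuffles-[] (z ∷ ζ) f = +-identityʳ _

inserts-↭ : ∀ (x : A) σ {τ} → τ ∈ inserts x σ → τ ↭ x ∷ σ
inserts-↭ x []      (here ≡.refl) = ↭-refl
inserts-↭ x (y ∷ σ) (here ≡.refl) = ↭-refl
inserts-↭ x (y ∷ σ) (there m) with ∈-map⁻ (y ∷_) m
... | τ , τ∈ , ≡.refl = ↭-trans (prep y (inserts-↭ x σ τ∈)) (swap y x ↭-refl)

perms-↭ : ∀ (U : List A) {σ} → σ ∈ perms U → σ ↭ U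
perms-↭ []      (here ≡.refl) = ↭-refl
perms-↭ (x ∷ U) m with ∈-concat⁻′ (map (inserts x) (perms U)) m
... | l , σ∈l , l∈ with ∈-map⁻ (inserts x) l∈
... | τ , τ∈ , ≡.refl = ↭-trans (inserts-↭ x τ σ∈l) (prep x (perms-↭ U τ∈))

length-inserts : ∀ (x : A) σ → length (inserts x σ) ≡ suc (length σ)
length-inserts x []      = ≡.refl
length-inserts x (y ∷ σ) = cong suc (≡.trans (length-map _ (inserts x σ)) (length-inserts x σ))

∑-perms-const : ∀ (U : List A) c → ∑ (perms U) (const c) ≡ length U ! * c
∑-perms-const []      c = ≡.refl
∑-perms-const (x ∷ U) c = begin
  ∑ (perms (x ∷ U)) (const c)
    ≡⟨ ∑-perms-∷ x U _ ⟩
  ∑ (perms U) (λ σ → ∑ (inserts x σ) (const c))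
    ≡⟨ ∑-cong-∈ (perms U) (λ {σ} σ∈ → ≡.trans (∑-const (inserts x σ) c)
         (cong (_* c) (≡.trans (length-inserts x σ) (cong suc (↭-length (perms-↭ U σ∈)))))) ⟩
  ∑ (perms U) (const (suc (length U) * c))
    ≡⟨ ∑-perms-const U _ ⟩
  length U ! * (suc (length U) * c)
    ≡⟨ reorder (length U !) (suc (length U)) c ⟩
  suc (length U) ! * c ∎
  where
  open ≡-Reasoning
  reorder : ∀ a b c → a * (b * c) ≡ b * a * c
  reorder = solve-∀

-- Peeling off the head `a`, the terms with `x` or `y` in front of it match crosswise; only those
-- with both behind it need induction.
∑-inserts-comm : ∀ (x y : A) σ f →
  ∑ (inserts y σ) (λ τ → ∑ (inserts x τ) f) ≡ ∑ (inserts x σ) (λ τ → ∑ (inserts y τ) f)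
∑-inserts-comm x y [] f = begin
  ∑ (inserts x (y ∷ [])) f + 0      ≡⟨ cong (_+ 0) (∑-inserts-∷ x y [] f) ⟩
  f (x ∷ y ∷ []) + (f (y ∷ x ∷ []) + 0) + 0
    ≡⟨ reorder (f (x ∷ y ∷ [])) (f (y ∷ x ∷ [])) ⟩
  f (y ∷ x ∷ []) + (f (x ∷ y ∷ []) + 0) + 0
    ≡⟨ cong (_+ 0) (∑-inserts-∷ y x [] f) ⟨
  ∑ (inserts y (x ∷ [])) f + 0 ∎
  where
  open ≡-Reasoning
  reorder : ∀ a b → a + (b + 0) + 0 ≡ b + (a + 0) + 0
  reorder = solve-∀
∑-inserts-comm x y (a ∷ σ) f = begin
  ∑ (inserts y (a ∷ σ)) (λ τ → ∑ (inserts x τ) f)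
    ≡⟨ expand x y ⟩
  f (x ∷ y ∷ a ∷ σ) + (f (y ∷ x ∷ a ∷ σ) + X) + (Y + XY)
    ≡⟨ cong (λ ● → f (x ∷ y ∷ a ∷ σ) + (f (y ∷ x ∷ a ∷ σ) + X) + (Y + ●))
         (∑-inserts-comm x y σ (f ∘ (a ∷_))) ⟩
  f (x ∷ y ∷ a ∷ σ) + (f (y ∷ x ∷ a ∷ σ) + X) + (Y + YX)
    ≡⟨ reorder (f (x ∷ y ∷ a ∷ σ)) (f (y ∷ x ∷ a ∷ σ)) X Y YX ⟩
  f (y ∷ x ∷ a ∷ σ) + (f (x ∷ y ∷ a ∷ σ) + Y) + (X + YX)
    ≡⟨ expand y x ⟨
  ∑ (inserts x (a ∷ σ)) (λ τ → ∑ (inserts y τ) f) ∎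
  where
  open ≡-Reasoning
  X  = ∑ (inserts x σ) (λ τ → f (y ∷ a ∷ τ))
  Y  = ∑ (inserts y σ) (λ τ → f (x ∷ a ∷ τ))
  XY = ∑ (inserts y σ) (λ τ → ∑ (inserts x τ) (f ∘ (a ∷_)))
  YX = ∑ (inserts x σ) (λ τ → ∑ (inserts y τ) (f ∘ (a ∷_)))
  reorder : ∀ p q X Y Z → p + (q + X) + (Y + Z) ≡ q + (p + Y) + (X + Z)
  reorder = solve-∀
  expand : ∀ x y → ∑ (inserts y (a ∷ σ)) (λ τ → ∑ (inserts x τ) f) ≡
    f (x ∷ y ∷ a ∷ σ) + (f (y ∷ x ∷ a ∷ σ) + ∑ (inserts x σ) (λ τ → f (y ∷ a ∷ τ)))
    + (∑ (inserts y σ) (λ τ → f (x ∷ a ∷ τ)) + ∑ (inserts y σ) (λ τ → ∑ (inserts x τ) (f ∘ (a ∷_))))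
  expand x y = ≡.trans (∑-inserts-∷ y a σ _) (cong₂ _+_
    (≡.trans (∑-inserts-∷ x y (a ∷ σ) f)
      (cong (f (x ∷ y ∷ a ∷ σ) +_) (∑-inserts-∷ x a σ (f ∘ (y ∷_)))))
    (≡.trans (∑-cong (inserts y σ) (λ τ → ∑-inserts-∷ x a τ f)) (∑-+ (inserts y σ) _ _)))

-- Lets an edge set be listed in whatever order suits, later as the out-edges of a vertex followed
-- by the others.
∑-perms-↭ : ∀ {U V : List A} f → U ↭ V → ∑ (perms U) f ≡ ∑ (perms V) f
∑-perms-↭ f refl = ≡.refl
∑-perms-↭ {U = x ∷ U} {x ∷ V} f (prep x p) =
  ≡.trans (∑-perms-∷ x U f) (≡.trans (∑-perms-↭ _ p) (sym (∑-perms-∷ x V f)))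
∑-perms-↭ {U = x ∷ y ∷ U} {y ∷ x ∷ V} f (swap x y p) = begin
  ∑ (perms (x ∷ y ∷ U)) f
    ≡⟨ ≡.trans (∑-perms-∷ x (y ∷ U) f) (∑-perms-∷ y U _) ⟩
  ∑ (perms U) (λ σ → ∑ (inserts y σ) (λ τ → ∑ (inserts x τ) f))
    ≡⟨ ∑-cong (perms U) (λ σ → ∑-inserts-comm x y σ f) ⟩
  ∑ (perms U) (λ σ → ∑ (inserts x σ) (λ τ → ∑ (inserts y τ) f))
    ≡⟨ ∑-perms-↭ _ p ⟩
  ∑ (perms V) (λ σ → ∑ (inserts x σ) (λ τ → ∑ (inserts y τ) f))
    ≡⟨ ≡.trans (∑-perms-∷ y (x ∷ V) f) (∑-perms-∷ x V _) ⟨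
  ∑ (perms (y ∷ x ∷ V)) f ∎
  where open ≡-Reasoning
∑-perms-↭ f (trans p q) = ≡.trans (∑-perms-↭ f p) (∑-perms-↭ f q)

-- Erasing the entries of `ω` from a shuffle with `z` inserted shows where `z` stands in `ζ`, so
-- inserting and shuffling can be exchanged.
∑-inserts-shuffles : ∀ (z : A) ζ ω f →
  ∑ (shuffles ζ ω) (λ σ → ∑ (inserts z σ) f) ≡ ∑ (inserts z ζ) (λ ζ′ → ∑ (shuffles ζ′ ω) f)
∑-inserts-shuffles z [] ω f = cong (_+ 0) (single ω f)
  where
  single : ∀ ω f → ∑ (inserts z ω) f ≡ ∑ (shuffles (z ∷ []) ω) f
  single []      f = ≡.refl
  single (w ∷ ω) f = ≡.trans (∑-inserts-∷ z w ω f) (≡.trans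
    (cong₂ _+_ (sym (+-identityʳ _)) (single ω (f ∘ (w ∷_)))) (sym (∑-shuffles-∷ z w [] ω f)))
∑-inserts-shuffles z (a ∷ ζ) [] f =
  ≡.trans (+-identityʳ _) (∑-cong (inserts z (a ∷ ζ)) (λ ζ′ → sym (∑-shuffles-[] ζ′ f)))
∑-inserts-shuffles z (a ∷ ζ) (w ∷ ω) f = begin
  ∑ (shuffles (a ∷ ζ) (w ∷ ω)) (λ σ → ∑ (inserts z σ) f)
    ≡⟨ ∑-shuffles-∷ a w ζ ω _ ⟩
  ∑ (shuffles ζ (w ∷ ω)) (λ σ → ∑ (inserts z (a ∷ σ)) f) +
  ∑ (shuffles (a ∷ ζ) ω) (λ σ → ∑ (inserts z (w ∷ σ)) f)
    ≡⟨ cong₂ _+_ (split a (shuffles ζ (w ∷ ω))) (split w (shuffles (a ∷ ζ) ω)) ⟩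
  (P + ∑ (shuffles ζ (w ∷ ω)) (λ σ → ∑ (inserts z σ) (f ∘ (a ∷_)))) +
  (Q + ∑ (shuffles (a ∷ ζ) ω) (λ σ → ∑ (inserts z σ) (f ∘ (w ∷_))))
    ≡⟨ cong₂ (λ ● ○ → P + ● + (Q + ○)) (∑-inserts-shuffles z ζ (w ∷ ω) (f ∘ (a ∷_)))
         (≡.trans (∑-inserts-shuffles z (a ∷ ζ) ω (f ∘ (w ∷_))) (∑-inserts-∷ z a ζ _)) ⟩
  (P + R) + (Q + (T + V))
    ≡⟨ reorder P R Q T V ⟩
  (P + Q + T) + (R + V)
    ≡⟨ cong₂ _+_ (≡.trans (∑-shuffles-∷ z w (a ∷ ζ) ω f)
                   (cong (_+ T) (∑-shuffles-∷ a w ζ ω (f ∘ (z ∷_)))))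
         (≡.trans (∑-cong (inserts z ζ) (λ ζ′ → ∑-shuffles-∷ a w ζ′ ω f)) (∑-+ (inserts z ζ) _ _)) ⟨
  ∑ (shuffles (z ∷ a ∷ ζ) (w ∷ ω)) f + ∑ (inserts z ζ) (λ ζ′ → ∑ (shuffles (a ∷ ζ′) (w ∷ ω)) f)
    ≡⟨ ∑-inserts-∷ z a ζ _ ⟨
  ∑ (inserts z (a ∷ ζ)) (λ ζ′ → ∑ (shuffles ζ′ (w ∷ ω)) f) ∎
  where
  open ≡-Reasoning
  P = ∑ (shuffles ζ (w ∷ ω)) (λ σ → f (z ∷ a ∷ σ))
  Q = ∑ (shuffles (a ∷ ζ) ω) (λ σ → f (z ∷ w ∷ σ))
  R = ∑ (inserts z ζ) (λ ζ′ → ∑ (shuffles ζ′ (w ∷ ω)) (f ∘ (a ∷_)))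
  T = ∑ (shuffles (z ∷ a ∷ ζ) ω) (f ∘ (w ∷_))
  V = ∑ (inserts z ζ) (λ ζ′ → ∑ (shuffles (a ∷ ζ′) ω) (f ∘ (w ∷_)))
  reorder : ∀ P R Q T V → (P + R) + (Q + (T + V)) ≡ (P + Q + T) + (R + V)
  reorder = solve-∀
  split : ∀ b L → ∑ L (λ σ → ∑ (inserts z (b ∷ σ)) f) ≡
    ∑ L (λ σ → f (z ∷ b ∷ σ)) + ∑ L (λ σ → ∑ (inserts z σ) (f ∘ (b ∷_)))
  split b L = ≡.trans (∑-cong L (λ σ → ∑-inserts-∷ z b σ f)) (∑-+ L _ _)

-- Takes the place of independence: the order within `Z`, the order within `W` and the interleaving
-- are summed over separately.
∑-perms-++ : ∀ (Z W : List A) f →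
  ∑ (perms (Z ++ W)) f ≡ ∑ (perms Z) (λ ζ → ∑ (perms W) (λ ω → ∑ (shuffles ζ ω) f))
∑-perms-++ [] W f = ≡.trans (∑-cong (perms W) (λ ω → sym (+-identityʳ (f ω)))) (sym (+-identityʳ _))
∑-perms-++ (z ∷ Z) W f = begin
  ∑ (perms (z ∷ Z ++ W)) f
    ≡⟨ ∑-perms-∷ z (Z ++ W) f ⟩
  ∑ (perms (Z ++ W)) (λ σ → ∑ (inserts z σ) f)
    ≡⟨ ∑-perms-++ Z W _ ⟩
  ∑ (perms Z) (λ ζ → ∑ (perms W) (λ ω → ∑ (shuffles ζ ω) (λ σ → ∑ (inserts z σ) f)))
    ≡⟨ ∑-cong (perms Z) (λ ζ → ≡.trans (∑-cong (perms W) (λ ω → ∑-inserts-shuffles z ζ ω f))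
         (∑-swap (perms W) (inserts z ζ) _)) ⟩
  ∑ (perms Z) (λ ζ → ∑ (inserts z ζ) (λ ζ′ → ∑ (perms W) (λ ω → ∑ (shuffles ζ′ ω) f)))
    ≡⟨ ∑-perms-∷ z Z _ ⟨
  ∑ (perms (z ∷ Z)) (λ ζ → ∑ (perms W) (λ ω → ∑ (shuffles ζ ω) f)) ∎
  where open ≡-Reasoning

-- Dropping an initial segment of a shuffle

-- How many entries of two lists, of lengths x and y, survive dropping the first t entries of a
-- shuffle: one pair for each way to shuffle those t entries.
cuts : ℕ → ℕ → ℕ → List (ℕ × ℕ)
cuts zero    x       y       = [ x , y ]
cuts (suc t) zero    zero    = [ zero , zero ]
cuts (suc t) zero    (suc y) = cuts t zero y
cuts (suc t) (suc x) zero    = cuts t x zero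
cuts (suc t) (suc x) (suc y) = cuts t x (suc y) ++ cuts t (suc x) y

cuts-≤ : ∀ t x y {x′ y′} → (x′ , y′) ∈ cuts t x y → x′ ≤ x × y′ ≤ y
cuts-≤ zero    x       y       (here ≡.refl) = ≤-refl , ≤-refl
cuts-≤ (suc t) zero    zero    (here ≡.refl) = ≤-refl , ≤-refl
cuts-≤ (suc t) zero    (suc y) m with cuts-≤ t zero y m
... | p , q = p , m≤n⇒m≤1+n q
cuts-≤ (suc t) (suc x) zero    m with cuts-≤ t x zero m
... | p , q = m≤n⇒m≤1+n p , q
cuts-≤ (suc t) (suc x) (suc y) m with ∈-++⁻ (cuts t x (suc y)) m
... | inj₁ m′ = let p , q = cuts-≤ t x (suc y) m′ in m≤n⇒m≤1+n p , q
... | inj₂ m′ = let p , q = cuts-≤ t (suc x) y m′ in p , m≤n⇒m≤1+n q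

-- Counted from the end, so that entries put in front do not matter and the pairs in `cuts`, which
-- tell what survives, can serve as indices.
final : ℕ → List A → List A
final k σ = drop (length σ ∸ k) σ

final-∷ : ∀ k (a : A) σ → k ≤ length σ → final k (a ∷ σ) ≡ final k σ
final-∷ k a σ k≤ = cong (λ i → drop i (a ∷ σ)) (+-∸-assoc 1 k≤)

final-all : ∀ (σ : List A) → final (length σ) σ ≡ σ
final-all σ = cong (λ i → drop i σ) (n∸n≡0 (length σ))

length-final : ∀ k (σ : List A) → k ≤ length σ → length (final k σ) ≡ k
length-final k σ k≤ = ≡.trans (length-drop (length σ ∸ k) σ) (m∸[m∸n]≡n k≤)

final-final : ∀ j k (σ : List A) → j ≤ k → k ≤ length σ → final j (final k σ) ≡ final j σ
final-final j k σ j≤k k≤ = ≡.trans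
  (drop-drop (length σ ∸ k) (length (final k σ) ∸ j) σ)
  (cong (λ i → drop i σ) (≡.trans (cong (λ l → length σ ∸ k + (l ∸ j)) (length-final k σ k≤))
    (≡.trans (sym (+-∸-assoc (length σ ∸ k) j≤k)) (cong (_∸ j) (m∸n+n≡m k≤)))))

-- Each way to interleave the dropped entries is followed by every shuffle of the two surviving end
-- segments exactly once.
∑-shuffles-drop : ∀ t (ζ ω : List A) f →
  ∑ (shuffles ζ ω) (f ∘ drop t) ≡
  ∑ (cuts t (length ζ) (length ω)) (λ (x , y) → ∑ (shuffles (final x ζ) (final y ω)) f)
∑-shuffles-drop zero ζ ω f = ≡.trans
  (cong₂ (λ ζ ω → ∑ (shuffles ζ ω) f) (sym (final-all ζ)) (sym (final-all ω))) (sym (+-identityʳ _))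
∑-shuffles-drop (suc t) [] [] f = sym (+-identityʳ _)
∑-shuffles-drop (suc t) [] (w ∷ ω) f = ≡.trans (∑-shuffles-drop t [] ω f)
  (∑-cong-∈ (cuts t 0 (length ω)) (λ {(x , y)} m →
    cong (λ l → ∑ (shuffles (final x []) l) f) (sym (final-∷ y w ω (proj₂ (cuts-≤ t 0 _ m))))))
∑-shuffles-drop (suc t) (z ∷ ζ) [] f = ≡.trans (+-identityʳ _) (≡.trans
  (≡.trans (sym (∑-shuffles-[] ζ (f ∘ drop t))) (∑-shuffles-drop t ζ [] f))
  (∑-cong-∈ (cuts t (length ζ) 0) (λ {(x , y)} m →
    cong (λ l → ∑ (shuffles l (final y [])) f) (sym (final-∷ x z ζ (proj₁ (cuts-≤ t _ 0 m)))))))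
∑-shuffles-drop (suc t) (z ∷ ζ) (w ∷ ω) f = begin
  ∑ (shuffles (z ∷ ζ) (w ∷ ω)) (f ∘ drop (suc t))
    ≡⟨ ∑-shuffles-∷ z w ζ ω _ ⟩
  ∑ (shuffles ζ (w ∷ ω)) (f ∘ drop t) + ∑ (shuffles (z ∷ ζ) ω) (f ∘ drop t)
    ≡⟨ cong₂ _+_ (∑-shuffles-drop t ζ (w ∷ ω) f) (∑-shuffles-drop t (z ∷ ζ) ω f) ⟩
  ∑ (cuts t (length ζ) (suc (length ω))) (rest ζ (w ∷ ω)) +
  ∑ (cuts t (suc (length ζ)) (length ω)) (rest (z ∷ ζ) ω)
    ≡⟨ cong₂ _+_
         (∑-cong-∈ (cuts t (length ζ) (suc (length ω))) (λ {(x , y)} m →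
           cong (λ l → ∑ (shuffles l (final y (w ∷ ω))) f)
             (sym (final-∷ x z ζ (proj₁ (cuts-≤ t _ _ m))))))
         (∑-cong-∈ (cuts t (suc (length ζ)) (length ω)) (λ {(x , y)} m →
           cong (λ l → ∑ (shuffles (final x (z ∷ ζ)) l) f)
             (sym (final-∷ y w ω (proj₂ (cuts-≤ t _ _ m)))))) ⟩
  ∑ (cuts t (length ζ) (suc (length ω))) (rest (z ∷ ζ) (w ∷ ω)) +
  ∑ (cuts t (suc (length ζ)) (length ω)) (rest (z ∷ ζ) (w ∷ ω))
    ≡⟨ ∑-++ (cuts t (length ζ) (suc (length ω))) _ _ ⟨
  ∑ (cuts (suc t) (suc (length ζ)) (suc (length ω))) (rest (z ∷ ζ) (w ∷ ω)) ∎
  where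
  open ≡-Reasoning
  rest : List _ → List _ → ℕ × ℕ → ℕ
  rest ζ ω (x , y) = ∑ (shuffles (final x ζ) (final y ω)) f

-- The entry at a fixed position of a random order

atHead : (A → ℕ) → List A → ℕ
atHead κ []      = 0
atHead κ (x ∷ _) = κ x

∑-inserts-atHead : ∀ (z : A) κ ζ →
  ∑ (inserts z ζ) (atHead κ) ≡ κ z + length ζ * atHead κ ζ
∑-inserts-atHead z κ []      = ≡.refl
∑-inserts-atHead z κ (a ∷ ζ) = cong (κ z +_) (≡.trans (∑-map (a ∷_) (inserts z ζ) (atHead κ))
  (≡.trans (∑-const (inserts z ζ) (κ a)) (cong (_* κ a) (length-inserts z ζ))))

-- Of the places for `z`, the first `suc i` push entry `i` of `ζ` into the inspected position, one
-- puts `z` there, and the last `k` leave it to entry `suc i`.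
∑-inserts-atHead-drop : ∀ (z : A) κ i k ζ → length ζ ≡ suc i + k →
  ∑ (inserts z ζ) (atHead κ ∘ drop (suc i)) ≡
  suc i * atHead κ (drop i ζ) + κ z + k * atHead κ (drop (suc i) ζ)
∑-inserts-atHead-drop z κ zero k (a ∷ ζ) eq = ≡.trans (∑-inserts-∷ z a ζ _) (≡.trans
  (cong (κ a +_) (≡.trans (∑-inserts-atHead z κ ζ)
    (cong (λ l → κ z + l * atHead κ ζ) (suc-injective eq))))
  (reassoc (κ a) (κ z) (k * atHead κ ζ)))
  where
  reassoc : ∀ a b c → a + (b + c) ≡ 1 * a + b + c
  reassoc = solve-∀
∑-inserts-atHead-drop z κ (suc i) k (a ∷ ζ) eq = ≡.trans (∑-inserts-∷ z a ζ _) (≡.trans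
  (cong (atHead κ (drop i ζ) +_) (∑-inserts-atHead-drop z κ i k ζ (suc-injective eq)))
  (reassoc (atHead κ (drop i ζ)) (suc i) (κ z) (k * atHead κ (drop (suc i) ζ))))
  where
  reassoc : ∀ a i b c → a + (i * a + b + c) ≡ suc i * a + b + c
  reassoc = solve-∀

-- Every entry stands at position `i` in equally many orders. This is the uniformity of the next
-- vertex.
∑-perms-atHead : ∀ (z : A) Z κ i k → length Z ≡ i + k →
  ∑ (perms (z ∷ Z)) (atHead κ ∘ drop i) ≡ length Z ! * ∑ (z ∷ Z) κ
∑-perms-atHead z [] κ zero zero eq = sym (+-identityʳ (κ z + 0))
∑-perms-atHead z (z′ ∷ Z) κ zero k eq = begin
  ∑ (perms (z ∷ z′ ∷ Z)) (atHead κ)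
    ≡⟨ ∑-perms-∷ z (z′ ∷ Z) _ ⟩
  ∑ (perms (z′ ∷ Z)) (λ ζ → ∑ (inserts z ζ) (atHead κ))
    ≡⟨ ∑-cong-∈ (perms (z′ ∷ Z)) (λ {ζ} m → ≡.trans (∑-inserts-atHead z κ ζ)
         (cong (λ l → κ z + l * atHead κ ζ) (↭-length (perms-↭ (z′ ∷ Z) m)))) ⟩
  ∑ (perms (z′ ∷ Z)) (λ ζ → κ z + suc l * atHead κ ζ)
    ≡⟨ ∑-+ (perms (z′ ∷ Z)) _ _ ⟩
  ∑ (perms (z′ ∷ Z)) (const (κ z)) + ∑ (perms (z′ ∷ Z)) (λ ζ → suc l * atHead κ ζ)
    ≡⟨ cong₂ _+_ (∑-perms-const (z′ ∷ Z) (κ z)) (≡.trans (∑-*ˡ (suc l) (perms (z′ ∷ Z)) _)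
         (cong (suc l *_) (∑-perms-atHead z′ Z κ 0 l ≡.refl))) ⟩
  suc l ! * κ z + suc l * (l ! * ∑ (z′ ∷ Z) κ)
    ≡⟨ collect (suc l) (l !) (κ z) (∑ (z′ ∷ Z) κ) ⟩
  suc l ! * ∑ (z ∷ z′ ∷ Z) κ ∎
  where
  open ≡-Reasoning
  l = length Z
  collect : ∀ l f a b → l * f * a + l * (f * b) ≡ l * f * (a + b)
  collect = solve-∀
∑-perms-atHead z (z′ ∷ Z) κ (suc i) k eq = begin
  ∑ (perms (z ∷ z′ ∷ Z)) (atHead κ ∘ drop (suc i))
    ≡⟨ ∑-perms-∷ z (z′ ∷ Z) _ ⟩
  ∑ (perms (z′ ∷ Z)) (λ ζ → ∑ (inserts z ζ) (atHead κ ∘ drop (suc i)))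
    ≡⟨ ∑-cong-∈ (perms (z′ ∷ Z)) (λ {ζ} m → ∑-inserts-atHead-drop z κ i k ζ
         (≡.trans (↭-length (perms-↭ (z′ ∷ Z) m)) eq)) ⟩
  ∑ (perms (z′ ∷ Z)) (λ ζ → suc i * atHead κ (drop i ζ) + κ z + k * atHead κ (drop (suc i) ζ))
    ≡⟨ ≡.trans (∑-+ (perms (z′ ∷ Z)) _ _) (cong (_+ _) (∑-+ (perms (z′ ∷ Z)) _ _)) ⟩
  ∑ (perms (z′ ∷ Z)) (λ ζ → suc i * atHead κ (drop i ζ)) + ∑ (perms (z′ ∷ Z)) (const (κ z)) +
  ∑ (perms (z′ ∷ Z)) (λ ζ → k * atHead κ (drop (suc i) ζ))
    ≡⟨ cong₂ _+_ (cong₂ _+_ (≡.trans (∑-*ˡ (suc i) (perms (z′ ∷ Z)) _)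
         (cong (suc i *_) (∑-perms-atHead z′ Z κ i k (suc-injective eq))))
         (∑-perms-const (z′ ∷ Z) (κ z)))
         (≡.trans (∑-*ˡ k (perms (z′ ∷ Z)) _) (later k eq)) ⟩
  suc i * (l ! * S) + suc l ! * κ z + k * (l ! * S)
    ≡⟨ collect₁ (suc i) k (l ! * S) (suc l ! * κ z) ⟩
  suc l ! * κ z + (suc i + k) * (l ! * S)
    ≡⟨ cong (λ n → suc l ! * κ z + n * (l ! * S)) (sym eq) ⟩
  suc l ! * κ z + suc l * (l ! * S)
    ≡⟨ collect₂ (suc l) (l !) (κ z) S ⟩
  suc l ! * ∑ (z ∷ z′ ∷ Z) κ ∎
  where
  open ≡-Reasoning
  l = length Z
  S = ∑ (z′ ∷ Z) κ
  later : ∀ k → suc l ≡ suc i + k →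
    k * ∑ (perms (z′ ∷ Z)) (atHead κ ∘ drop (suc i)) ≡ k * (l ! * S)
  -- Here position `suc i` lies past the end and the induction hypothesis does not apply, but the
  -- factor is 0.
  later zero    eq = ≡.refl
  later (suc k) eq = cong (suc k *_)
    (∑-perms-atHead z′ Z κ (suc i) k (≡.trans (suc-injective eq) (+-suc i k)))
  collect₁ : ∀ i k b a → i * b + a + k * b ≡ a + (i + k) * b
  collect₁ = solve-∀
  collect₂ : ∀ l f a b → l * f * a + l * (f * b) ≡ l * f * (a + b)
  collect₂ = solve-∀

-- Binomial estimates

pascal : ∀ n k → suc n C suc k ≡ n C k + n C suc k
pascal n k = sym (nCk+nC[k+1]≡[n+1]C[k+1] n k)

absorption : ∀ n k → suc k * (suc n C suc k) ≡ suc n * (n C k)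
absorption zero    zero    = ≡.refl
absorption zero    (suc k) = *-zeroʳ (suc (suc k))
absorption (suc n) zero    =
  ≡.trans (+-identityʳ _) (≡.trans (nC1≡n (suc (suc n))) (sym (*-identityʳ _)))
absorption (suc n) (suc k) = begin
  (2 + k) * (suc (suc n) C suc (suc k))
    ≡⟨ cong ((2 + k) *_) (pascal (suc n) (suc k)) ⟩
  (2 + k) * (c + suc n C suc (suc k))
    ≡⟨ split k c (suc n C suc (suc k)) ⟩
  c + (suc k * c + (2 + k) * (suc n C suc (suc k)))
    ≡⟨ cong (c +_) (cong₂ _+_ (absorption n k) (absorption n (suc k))) ⟩
  c + (suc n * (n C k) + suc n * (n C suc k))
    ≡⟨ cong (c +_) (≡.trans (sym (*-distribˡ-+ (suc n) (n C k) _))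
         (cong (suc n *_) (sym (pascal n k)))) ⟩
  (2 + n) * c ∎
  where
  open ≡-Reasoning
  c = suc n C suc k
  split : ∀ k c e → (2 + k) * (c + e) ≡ c + (suc k * c + (2 + k) * e)
  split = solve-∀

nC[k+1]-ratio : ∀ k m → suc k * ((k + m) C suc k) ≡ m * ((k + m) C k)
nC[k+1]-ratio k m = +-cancelˡ-≡ (suc k * c) _ _ (begin
  suc k * c + suc k * ((k + m) C suc k)   ≡⟨ *-distribˡ-+ (suc k) c _ ⟨
  suc k * (c + (k + m) C suc k)           ≡⟨ cong (suc k *_) (pascal (k + m) k) ⟨
  suc k * (suc (k + m) C suc k)           ≡⟨ absorption (k + m) k ⟩
  (suc k + m) * c                         ≡⟨ *-distribʳ-+ c (suc k) m ⟩
  suc k * c + m * c                       ∎)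
  where
  open ≡-Reasoning
  c = (k + m) C k

-- The weight `j` is absorbed by j * ((x + j) C x) = suc x * ((x + j) C suc x); both parts are then
-- hockey-stick sums.
∑-hockeyStick : ∀ a b x y →
  ∑ (downFrom (suc y)) (λ j → ((x + j) C x) * (a + b * j)) ≡
  a * ((suc x + y) C suc x) + b * (suc x * ((suc x + y) C suc (suc x)))
∑-hockeyStick a b x zero
  rewrite +-identityʳ x | nCn≡1 x | nCn≡1 (suc x) | k>n⇒nCk≡0 (n<1+n (suc x)) = reorder a b x
  where
  reorder : ∀ a b x → a + b * 0 + 0 + 0 ≡ a * 1 + b * (suc x * 0)
  reorder = solve-∀
∑-hockeyStick a b x (suc y)
  rewrite ∑-hockeyStick a b x y | +-suc x y | pascal (suc (x + y)) x | pascal (suc (x + y)) (suc x)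
  = begin
  (n C x) * (a + b * suc y) + (a * (n C suc x) + b * (suc x * (n C suc (suc x))))
    ≡⟨ reorder₁ a b (suc x) (suc y) (n C x) (n C suc x) (n C suc (suc x)) ⟩
  a * (n C x + n C suc x) + b * (suc y * (n C x) + suc x * (n C suc (suc x)))
    ≡⟨ cong (λ ● → a * (n C x + n C suc x) + b * (● + suc x * (n C suc (suc x)))) ratio ⟨
  a * (n C x + n C suc x) + b * (suc x * (n C suc x) + suc x * (n C suc (suc x)))
    ≡⟨ cong (λ ● → a * (n C x + n C suc x) + b * ●) (*-distribˡ-+ (suc x) (n C suc x) _) ⟨
  a * (n C x + n C suc x) + b * (suc x * (n C suc x + n C suc (suc x))) ∎
  where
  open ≡-Reasoning
  n = suc (x + y)
  ratio : suc x * (n C suc x) ≡ suc y * (n C x)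
  ratio = subst (λ m → suc x * (m C suc x) ≡ suc y * (m C x)) (+-suc x y) (nC[k+1]-ratio x (suc y))
  reorder₁ : ∀ a b x y p q r →
    p * (a + b * y) + (a * q + b * (x * r)) ≡ a * (p + q) + b * (y * p + x * r)
  reorder₁ = solve-∀

-- In (x + j) C x of the shuffles of suc x special and y ordinary entries, exactly j ordinary entries
-- follow the first special one; such a shuffle is worth a + b * j.
gain : ℕ → ℕ → ℕ → ℕ → ℕ
gain a b zero    y = 0
gain a b (suc x) y = ∑ (downFrom (suc y)) (λ j → ((x + j) C x) * (a + b * j))

-- Without ordinary entries there is one cut, worth `a` unless all `x` special entries are gone, and
-- `t C x` is 1 exactly then.
∑-cuts-gain-0 : ∀ a b t x → t ≤ x →
  ∑ (cuts t x zero) (uncurry (gain a b)) + a * (t C x) ≡ a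
∑-cuts-gain-0 a b zero zero z≤n = *-identityʳ a
∑-cuts-gain-0 a b zero (suc x) z≤n rewrite +-identityʳ x | nCn≡1 x = reorder a b
  where
  reorder : ∀ a b → a + b * 0 + 0 + 0 + 0 + a * 0 ≡ a
  reorder = solve-∀
∑-cuts-gain-0 a b (suc t) (suc x) (s≤s t≤x)
  rewrite pascal t x | k>n⇒nCk≡0 (s≤s t≤x) | +-identityʳ (t C x) = ∑-cuts-gain-0 a b t x t≤x

-- A double count with M = x + y. For `a`: of the M C x shuffles, t C x have no special entry after
-- the first t. For `b`: count the ordinary entries after the first t that have a special entry
-- between the cut and themselves. Each of the d places is ordinary in (M - 1) C x shuffles; those
-- with no special entry in between add up over the places to M C suc x - t C suc x. Subtracted
-- terms are moved across, and the proof is Pascal's rule.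
∑-cuts-gain : ∀ a b t d x y → t + d ≡ x + y →
  ∑ (cuts t x y) (uncurry (gain a b)) + a * (t C x) + b * ((x + y) C suc x) ≡
  a * ((x + y) C x) + b * (d * ((x + y ∸ 1) C x) + t C suc x)
∑-cuts-gain a b zero d zero y ≡.refl rewrite nC1≡n y = reorder a b y
  where
  reorder : ∀ a b y → 0 + a * 1 + b * y ≡ a * 1 + b * (y * 1 + 0)
  reorder = solve-∀
∑-cuts-gain a b zero d (suc x) y ≡.refl rewrite ∑-hockeyStick a b x y = begin
  a * p + b * (suc x * q) + 0 + a * 0 + b * q    ≡⟨ reorder a b (suc x) p q ⟩
  a * p + b * (suc (suc x) * q)                  ≡⟨ cong (λ ● → a * p + b * ●) (absorption (x + y) (suc x)) ⟩
  a * p + b * (suc (x + y) * ((x + y) C suc x))  ≡⟨ cong (λ ● → a * p + b * ●) (+-identityʳ _) ⟨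
  a * p + b * (suc (x + y) * ((x + y) C suc x) + 0) ∎
  where
  open ≡-Reasoning
  p = suc (x + y) C suc x
  q = suc (x + y) C suc (suc x)
  reorder : ∀ a b x p q → a * p + b * (x * q) + 0 + a * 0 + b * q ≡ a * p + b * (suc x * q)
  reorder = solve-∀
∑-cuts-gain a b (suc t) d zero (suc y) eq
  rewrite nC1≡n (suc y) | nC1≡n (suc t) = begin
  S + a * 1 + b * suc y    ≡⟨ reorder₁ S a b y ⟩
  S + a * 1 + b * y + b    ≡⟨ cong (_+ b) (subst (λ ● → S + a * 1 + b * ● ≡ _) (nC1≡n y)
                                (∑-cuts-gain a b t d zero y (suc-injective eq))) ⟩
  a * 1 + b * (d * 1 + t C 1) + b ≡⟨ cong (λ ● → a * 1 + b * (d * 1 + ●) + b) (nC1≡n t) ⟩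
  a * 1 + b * (d * 1 + t) + b ≡⟨ reorder₂ a b d t ⟩
  a * 1 + b * (d * 1 + suc t) ∎
  where
  open ≡-Reasoning
  S = ∑ (cuts t zero y) (uncurry (gain a b))
  reorder₁ : ∀ S a b y → S + a * 1 + b * suc y ≡ S + a * 1 + b * y + b
  reorder₁ = solve-∀
  reorder₂ : ∀ a b d t → a * 1 + b * (d * 1 + t) + b ≡ a * 1 + b * (d * 1 + suc t)
  reorder₂ = solve-∀
∑-cuts-gain a b (suc t) d (suc x) zero eq
  with t≤x ← m+n≤o⇒m≤o t (≤-reflexive (≡.trans (suc-injective eq) (+-identityʳ x)))
  rewrite +-identityʳ x | nCn≡1 (suc x)
        | k>n⇒nCk≡0 (n<1+n (suc x)) | k>n⇒nCk≡0 (n<1+n x)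
        | k>n⇒nCk≡0 (s≤s (s≤s t≤x))
  = ≡.trans (cong (_+ b * 0) (∑-cuts-gain-0 a b (suc t) (suc x) (s≤s t≤x))) (reorder a b d)
  where
  reorder : ∀ a b d → a + b * 0 ≡ a * 1 + b * (d * 0 + 0)
  reorder = solve-∀
∑-cuts-gain a b (suc t) d (suc x) (suc y) eq
  rewrite ∑-++ (cuts t x (suc y)) (cuts t (suc x) y) (uncurry (gain a b)) = begin
  S₁ + S₂ + a * (suc t C suc x) + b * ((suc x + suc y) C suc (suc x))
    ≡⟨ cong₂ (λ ● ○ → S₁ + S₂ + a * ● + b * ○) (pascal t x) (pascal n (suc x)) ⟩
  S₁ + S₂ + a * (t C x + t C suc x) + b * (n C suc x + n C suc (suc x))
    ≡⟨ reorder₁ a b S₁ S₂ (t C x) (t C suc x) (n C suc x) (n C suc (suc x)) ⟩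
  (S₁ + a * (t C x) + b * (n C suc x)) + (S₂ + a * (t C suc x) + b * (n C suc (suc x)))
    ≡⟨ cong₂ _+_ (∑-cuts-gain a b t d x (suc y) (suc-injective eq)) IH₂ ⟩
  (a * (n C x) + b * (d * ((n ∸ 1) C x) + t C suc x)) +
  (a * (n C suc x) + b * (d * ((n ∸ 1) C suc x) + t C suc (suc x)))
    ≡⟨ reorder₂ a b d (n C x) (n C suc x) ((n ∸ 1) C x) ((n ∸ 1) C suc x) (t C suc x) (t C suc (suc x)) ⟩
  a * (n C x + n C suc x) +
  b * (d * ((n ∸ 1) C x + (n ∸ 1) C suc x) + (t C suc x + t C suc (suc x)))
    ≡⟨ cong₂ (λ ● ○ → a * ● + b * (d * ○ + (t C suc x + t C suc (suc x)))) (sym (pascal n x)) last ⟩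
  a * (suc n C suc x) + b * (d * (n C suc x) + (t C suc x + t C suc (suc x)))
    ≡⟨ cong (λ ● → a * (suc n C suc x) + b * (d * (n C suc x) + ●)) (pascal t (suc x)) ⟨
  a * (suc n C suc x) + b * (d * (n C suc x) + suc t C suc (suc x)) ∎
  where
  open ≡-Reasoning
  n = x + suc y
  S₁ = ∑ (cuts t x (suc y)) (uncurry (gain a b))
  S₂ = ∑ (cuts t (suc x) y) (uncurry (gain a b))
  IH₂ : S₂ + a * (t C suc x) + b * (n C suc (suc x)) ≡
        a * (n C suc x) + b * (d * ((n ∸ 1) C suc x) + t C suc (suc x))
  IH₂ = subst (λ m → S₂ + a * (t C suc x) + b * (m C suc (suc x)) ≡
                      a * (m C suc x) + b * (d * ((m ∸ 1) C suc x) + t C suc (suc x)))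
          (sym (+-suc x y))
          (∑-cuts-gain a b t d (suc x) y (≡.trans (suc-injective eq) (+-suc x y)))
  last : (n ∸ 1) C x + (n ∸ 1) C suc x ≡ n C suc x
  last = subst (λ m → (m ∸ 1) C x + (m ∸ 1) C suc x ≡ m C suc x)
           (sym (+-suc x y)) (sym (pascal (x + y) x))
  reorder₁ : ∀ a b S T p q r s → S + T + a * (p + q) + b * (r + s) ≡
    (S + a * p + b * r) + (T + a * q + b * s)
  reorder₁ = solve-∀
  reorder₂ : ∀ a b d p q r s u v → (a * p + b * (d * r + u)) + (a * q + b * (d * s + v)) ≡
    a * (p + q) + b * (d * (r + s) + (u + v))
  reorder₂ = solve-∀

-- Concavity: the gain lies above its chord

-- A convex function lies above its tangent: each of the `d` increments from `n` on is at least
-- `n C k`.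
binomial-convex : ∀ k n d → n C suc k + d * (n C k) ≤ (n + d) C suc k
binomial-convex k n zero    rewrite +-identityʳ n | +-identityʳ (n C suc k) = ≤-refl
binomial-convex k n (suc d) rewrite +-suc n d | pascal (n + d) k = begin
  n C suc k + (n C k + d * (n C k))   ≡⟨ reorder (n C suc k) (n C k) (d * (n C k)) ⟩
  n C k + (n C suc k + d * (n C k))   ≤⟨ +-mono-≤ (C-monoˡ d) (binomial-convex k n d) ⟩
  (n + d) C k + (n + d) C suc k       ∎
  where
  open ≤-Reasoning
  reorder : ∀ p q r → p + (q + r) ≡ q + (p + r)
  reorder = solve-∀
  C-suc : ∀ n k → n C k ≤ suc n C k
  C-suc n zero    = ≤-refl
  C-suc n (suc k) rewrite pascal n k = m≤n+m _ (n C k)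
  C-monoˡ : ∀ d → n C k ≤ (n + d) C k
  C-monoˡ zero    rewrite +-identityʳ n = ≤-refl
  C-monoˡ (suc d) rewrite +-suc n d = ≤-trans (C-monoˡ d) (C-suc (n + d) k)

-- An equality when k ≤ n, since then w - d = n - k and (n - k) * (n C k) = suc k * (n C suc k); for
-- n < k the left side vanishes.
excess-bound : ∀ k w n d → n + d ≡ k + w → w * (n C k) ≤ d * (n C k) + suc k * (n C suc k)
excess-bound k w n d eq with <-≤-connex n k
... | inj₁ n<k rewrite k>n⇒nCk≡0 n<k | *-zeroʳ w = z≤n
... | inj₂ k≤n with m , ≡.refl ← m≤n⇒∃[o]m+o≡n k≤n = begin
  w * c                        ≡⟨ cong (_* c) w≡d+m ⟩
  (d + m) * c                  ≡⟨ *-distribʳ-+ c d m ⟩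
  d * c + m * c                ≡⟨ cong (d * c +_) (nC[k+1]-ratio k m) ⟨
  d * c + suc k * ((k + m) C suc k) ∎
  where
  open ≤-Reasoning
  c = (k + m) C k
  w≡d+m : w ≡ d + m
  w≡d+m = +-cancelˡ-≡ k w (d + m)
    (≡.trans (sym eq) (≡.trans (+-assoc k m d) (cong (k +_) (+-comm m d))))

-- Adding `k * (d * (n C k))` to three times `excess-bound` completes `k + 3` copies of the tangent
-- in `binomial-convex`; the split is 3 (k + 1) = (k + 3) + 2k.
tangent-bound : ∀ k w n d → n + d ≡ k + w →
  3 * (w * (n C k)) ≤ (k + 3) * ((k + w) C suc k) + 2 * k * (n C suc k)
tangent-bound k w n d eq = begin
  3 * (w * (n C k))
    ≤⟨ *-monoʳ-≤ 3 (excess-bound k w n d eq) ⟩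
  3 * (d * (n C k) + suc k * (n C suc k))
    ≤⟨ m≤m+n _ (k * (d * (n C k))) ⟩
  3 * (d * (n C k) + suc k * (n C suc k)) + k * (d * (n C k))
    ≡⟨ reorder k (n C suc k) (d * (n C k)) ⟩
  (k + 3) * (n C suc k + d * (n C k)) + 2 * k * (n C suc k)
    ≤⟨ +-monoˡ-≤ _ (*-monoʳ-≤ (k + 3) (binomial-convex k n d)) ⟩
  (k + 3) * ((n + d) C suc k) + 2 * k * (n C suc k)
    ≡⟨ cong (λ m → (k + 3) * (m C suc k) + 2 * k * (n C suc k)) eq ⟩
  (k + 3) * ((k + w) C suc k) + 2 * k * (n C suc k) ∎
  where
  open ≤-Reasoning
  reorder : ∀ k c e → 3 * (e + suc k * c) + k * e ≡ (k + 3) * (c + e) + 2 * k * c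
  reorder = solve-∀

-- Let X(t) be the sum evaluated by `∑-cuts-gain` for `suc k` special and `w` ordinary entries with
-- a = 3 (k + 1) w and b = 2k(k + 2), and let M = suc k + w. The claim amounts to M X(t) ≥ d X(0),
-- the chord from t = 0 to t = M, where X vanishes. The factor `k + 3` comes from a * (M C suc k) -
-- b * (M C suc (suc k)) = (k + 3) * w * (M C suc k). For t > 0, a factor t taken out by absorption
-- leaves `tangent-bound`.
secant-bound : ∀ k w t d → t + d ≡ suc k + w →
  3 * suc k * w * (suc k + w) * (t C suc k) ≤
  (k + 3) * t * w * ((suc k + w) C suc k) + 2 * k * (k + 2) * (suc k + w) * (t C suc (suc k))
secant-bound k w zero d eq rewrite *-zeroʳ (3 * suc k * w * (suc k + w)) = z≤n
secant-bound k w (suc n) d eq = *-cancelˡ-≤ (suc k) (begin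
  suc k * (3 * suc k * w * M * c)
    ≡⟨ reorder₁ (suc k) w M c ⟩
  3 * suc k * w * M * (suc k * c)
    ≡⟨ cong (3 * suc k * w * M *_) (absorption n k) ⟩
  3 * suc k * w * M * (suc n * (n C k))
    ≡⟨ reorder₂ (suc k) w M (suc n) (n C k) ⟩
  suc n * M * suc k * (3 * (w * (n C k)))
    ≤⟨ *-monoʳ-≤ (suc n * M * suc k) (tangent-bound k w n d (suc-injective eq)) ⟩
  suc n * M * suc k * ((k + 3) * ((k + w) C suc k) + 2 * k * (n C suc k))
    ≡⟨ reorder₃ k (suc n) M ((k + w) C suc k) (n C suc k) ⟩
  suc n * M * (k + 3) * (suc k * ((k + w) C suc k)) + 2 * k * suc k * M * (suc n * (n C suc k))
    ≡⟨ cong₂ (λ ● ○ → suc n * M * (k + 3) * ● + 2 * k * suc k * M * ○)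
         (nC[k+1]-ratio k w) (sym (absorption n (suc k))) ⟩
  suc n * M * (k + 3) * (w * ((k + w) C k)) + 2 * k * suc k * M * (suc (suc k) * c₁)
    ≡⟨ reorder₄ k w (suc n) M ((k + w) C k) c₁ ⟩
  (k + 3) * suc n * w * (M * ((k + w) C k)) + suc k * (2 * k * (k + 2) * M * c₁)
    ≡⟨ cong (λ ● → (k + 3) * suc n * w * ● + suc k * (2 * k * (k + 2) * M * c₁))
         (sym (absorption (k + w) k)) ⟩
  (k + 3) * suc n * w * (suc k * (M C suc k)) + suc k * (2 * k * (k + 2) * M * c₁)
    ≡⟨ reorder₅ (suc k) ((k + 3) * suc n * w) (M C suc k) (2 * k * (k + 2) * M * c₁) ⟩
  suc k * ((k + 3) * suc n * w * (M C suc k) + 2 * k * (k + 2) * M * c₁) ∎)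
  where
  open ≤-Reasoning
  M  = suc k + w
  c  = suc n C suc k
  c₁ = suc n C suc (suc k)
  reorder₁ : ∀ r w M c → r * (3 * r * w * M * c) ≡ 3 * r * w * M * (r * c)
  reorder₁ = solve-∀
  reorder₂ : ∀ r w M n c → 3 * r * w * M * (n * c) ≡ n * M * r * (3 * (w * c))
  reorder₂ = solve-∀
  reorder₃ : ∀ k n M p q → n * M * suc k * ((k + 3) * p + 2 * k * q) ≡
    n * M * (k + 3) * (suc k * p) + 2 * k * suc k * M * (n * q)
  reorder₃ = solve-∀
  reorder₄ : ∀ k w n M p q → n * M * (k + 3) * (w * p) + 2 * k * suc k * M * (suc (suc k) * q) ≡
    (k + 3) * n * w * (M * p) + suc k * (2 * k * (k + 2) * M * q)
  reorder₄ = solve-∀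
  reorder₅ : ∀ r e p q → e * (r * p) + r * q ≡ r * (e * p + q)
  reorder₅ = solve-∀

-- The chord bound turned into the constant of the induction. `X` is known only through an equation
-- with subtracted terms on its left, hence `loss + q * tangent` is carried on both sides and
-- cancelled.
gain-bound : ∀ k w t d X → t + d ≡ suc k + w →
  X + 3 * suc k * w * (t C suc k) + 2 * k * (k + 2) * ((suc k + w) C suc (suc k)) ≡
    3 * suc k * w * ((suc k + w) C suc k)
    + 2 * k * (k + 2) * (d * ((k + w) C suc k) + t C suc (suc k)) →
  2 * (suc k * suc k + suc k + 1) * d * w * suc k * ((suc k + w) C suc k) ≤
  suc (suc k) * (suc k + w) * X
gain-bound k w t d X eq hyp = +-cancelʳ-≤ (loss + q * tangent) _ _ (begin
  P + (loss + q * tangent)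
    -- The surplus given away: for r = k + 1, 2(r² + r + 1) + k = (2r + 1)(r + 1), the value on the
    -- chord.
    ≤⟨ m≤m+n _ (w * C₀ * suc k * k * d) ⟩
  P + (loss + q * tangent) + w * C₀ * suc k * k * d
    ≡⟨ balance k w t d M C₀ c c₁ eq ⟩
  won + q * (3 * suc k * w * M * c)
    ≤⟨ +-monoʳ-≤ won (*-monoʳ-≤ q (secant-bound k w t d eq)) ⟩
  won + q * tangent
    ≡⟨ cong (_+ q * tangent) scaled ⟨
  q * M * X + loss + q * tangent
    ≡⟨ +-assoc (q * M * X) loss _ ⟩
  q * M * X + (loss + q * tangent) ∎)
  where
  open ≤-Reasoning
  q  = suc (suc k)
  M  = suc k + w
  C₀ = M C suc k
  c  = t C suc k
  c₁ = t C q
  a  = 3 * suc k * w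
  b  = 2 * k * (k + 2)
  P  = 2 * (suc k * suc k + suc k + 1) * d * w * suc k * C₀
  tangent = (k + 3) * t * w * C₀ + 2 * k * (k + 2) * M * c₁
  loss = q * M * (a * c) + b * M * (w * C₀)
  won  = q * M * (a * C₀) + b * (d * (q * (w * C₀)) + q * M * c₁)
  balance : ∀ k w t d M C₀ c c₁ → t + d ≡ M →
    2 * (suc k * suc k + suc k + 1) * d * w * suc k * C₀
    + ((2 + k) * M * (3 * suc k * w * c) + 2 * k * (k + 2) * M * (w * C₀)
    + (2 + k) * ((k + 3) * t * w * C₀ + 2 * k * (k + 2) * M * c₁)) + w * C₀ * suc k * k * d
    ≡ (2 + k) * M * (3 * suc k * w * C₀)
    + 2 * k * (k + 2) * (d * ((2 + k) * (w * C₀)) + (2 + k) * M * c₁)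
    + (2 + k) * (3 * suc k * w * M * c)
  balance k w t d _ C₀ c c₁ ≡.refl = balance′ k w t d C₀ c c₁
    where
    balance′ : ∀ k w t d C₀ c c₁ →
      2 * (suc k * suc k + suc k + 1) * d * w * suc k * C₀
      + ((2 + k) * (t + d) * (3 * suc k * w * c) + 2 * k * (k + 2) * (t + d) * (w * C₀)
      + (2 + k) * ((k + 3) * t * w * C₀ + 2 * k * (k + 2) * (t + d) * c₁)) + w * C₀ * suc k * k * d
      ≡ (2 + k) * (t + d) * (3 * suc k * w * C₀)
      + 2 * k * (k + 2) * (d * ((2 + k) * (w * C₀)) + (2 + k) * (t + d) * c₁)
      + (2 + k) * (3 * suc k * w * (t + d) * c)
    balance′ = solve-∀
  reorder₁ : ∀ q M X a b c e → q * M * X + (q * M * (a * c) + b * M * (q * e)) ≡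
    q * M * (X + a * c + b * e)
  reorder₁ = solve-∀
  reorder₂ : ∀ q M a b d C e c₁ → q * M * (a * C + b * (d * e + c₁)) ≡
    q * M * (a * C) + b * (d * (q * (M * e)) + q * M * c₁)
  reorder₂ = solve-∀
  scaled : q * M * X + loss ≡ won
  scaled = ≡.trans
    (cong (λ ● → q * M * X + (q * M * (a * c) + b * M * ●)) (sym (nC[k+1]-ratio (suc k) w)))
    (≡.trans (reorder₁ q M X a b c (M C q)) (≡.trans (cong (q * M *_) hyp)
    (≡.trans (reorder₂ q M a b d C₀ ((k + w) C suc k) c₁)
    (cong (λ ● → q * M * (a * C₀) + b * (d * (q * ●) + q * M * c₁))
      (≡.trans (sym (absorption (k + w) (suc k))) (nC[k+1]-ratio (suc k) w))))))

factorial-split : ∀ x y → (x + y) ! ≡ x ! * (y ! * ((x + y) C x))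
factorial-split zero    y = reorder (y !)
  where
  reorder : ∀ f → f ≡ 1 * (f * 1)
  reorder = solve-∀
factorial-split (suc x) y = begin
  suc (x + y) * (x + y) !                              ≡⟨ cong (suc (x + y) *_) (factorial-split x y) ⟩
  suc (x + y) * (x ! * (y ! * ((x + y) C x)))          ≡⟨ reorder₁ (suc (x + y)) (x !) (y !) _ ⟩
  x ! * (y ! * (suc (x + y) * ((x + y) C x)))          ≡⟨ cong (λ ● → x ! * (y ! * ●)) (absorption (x + y) x) ⟨
  x ! * (y ! * (suc x * (suc (x + y) C suc x)))        ≡⟨ reorder₂ (suc x) (x !) (y !) _ ⟩
  suc x ! * (y ! * (suc (x + y) C suc x))              ∎
  where
  open ≡-Reasoning
  reorder₁ : ∀ n f g c → n * (f * (g * c)) ≡ f * (g * (n * c))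
  reorder₁ = solve-∀
  reorder₂ : ∀ n f g c → f * (g * (n * c)) ≡ n * f * (g * c)
  reorder₂ = solve-∀

-- The walk along a random edge order

next : ∀ {n} → Fin n → Edge n → Fin n
next v (a , b) = if does (a ≟ v) then b else v

walk : ∀ {n} → Fin n → List (Edge n) → Fin n
walk v []      = v
walk v (e ∷ σ) = walk (next v e) σ

next-skip : ∀ {n} {v : Fin n} e → proj₁ e ≢ v → next v e ≡ v
next-skip {v = v} (a , b) a≢v = cong (if_then b else v) (dec-false (a ≟ v) a≢v)

next-take : ∀ {n} {v : Fin n} e → proj₁ e ≡ v → next v e ≡ proj₂ e
next-take {v = v} (a , b) a≡v = cong (if_then b else v) (dec-true (a ≟ v) a≡v)

walk-skip : ∀ {n} {v : Fin n} σ → All (λ e → proj₁ e ≢ v) σ → walk v σ ≡ v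
walk-skip []      []       = ≡.refl
walk-skip (e ∷ σ) (p ∷ ps) rewrite next-skip e p = walk-skip σ ps

module Walk {n : ℕ} (T : Digraph n)
            (irreflexive : ∀ u → T u u ≢ true)
            (transitive : ∀ {u v w} → T u v ≡ true → T v w ≡ true → T u w ≡ true)
            (z : Fin n) where

  Arc : Edge n → Set
  Arc (a , b) = T a b ≡ true

  hits : Fin n → List (Edge n) → ℕ
  hits v σ = if does (walk v σ ≟ z) then 1 else 0

  below-next : ∀ {u v} e → Arc e → T u v ≡ true → T u (next v e) ≡ true
  below-next {u} {v} (a , b) ab uv with a ≟ v
  ... | yes ≡.refl = transitive uv ab
  ... | no  _      = uv

  below⇒≢ : ∀ {u v} → T u v ≡ true → u ≢ v
  below⇒≢ uv ≡.refl = irreflexive _ uv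

  -- By transitivity arcs keep a walk that is below `u` below `u`, so the entries of `ζ` never move
  -- it; the binomial coefficient counts shuffles with one and the same outcome.
  ∑-shuffles-below : ∀ {u v} ζ ω → All (λ e → proj₁ e ≡ u) ζ → All Arc ω → T u v ≡ true →
    ∑ (shuffles ζ ω) (hits v) ≡ ((length ζ + length ω) C length ζ) * hits v ω
  ∑-shuffles-below []      ω  _ _ _ = ≡.refl
  ∑-shuffles-below {u} {v} (e ∷ ζ) [] ps _ uv
    rewrite +-identityʳ (length ζ) | nCn≡1 (suc (length ζ))
          | walk-skip (e ∷ ζ) (All.map (λ p q → below⇒≢ uv (≡.trans (sym p) q)) ps) = ≡.refl
  ∑-shuffles-below {u} {v} (e ∷ ζ) (f ∷ ω) (p ∷ ps) (q ∷ qs) uv = begin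
    ∑ (shuffles (e ∷ ζ) (f ∷ ω)) (hits v)
      ≡⟨ ∑-shuffles-∷ e f ζ ω _ ⟩
    ∑ (shuffles ζ (f ∷ ω)) (hits (next v e)) + ∑ (shuffles (e ∷ ζ) ω) (hits (next v f))
      ≡⟨ cong₂ _+_ (≡.trans
           (cong (λ v′ → ∑ (shuffles ζ (f ∷ ω)) (hits v′)) (next-skip e (λ q → below⇒≢ uv (≡.trans (sym p) q))))
           (∑-shuffles-below ζ (f ∷ ω) ps (q ∷ qs) uv))
         (∑-shuffles-below (e ∷ ζ) ω (p ∷ ps) qs (below-next f q uv)) ⟩
    ((x + suc y) C x) * h + ((suc x + y) C suc x) * h
      ≡⟨ *-distribʳ-+ h ((x + suc y) C x) _ ⟨
    ((x + suc y) C x + (suc x + y) C suc x) * h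
      ≡⟨ cong (λ m → ((x + suc y) C x + m C suc x) * h) (+-suc x y) ⟨
    ((x + suc y) C x + (x + suc y) C suc x) * h
      ≡⟨ cong (_* h) (pascal (x + suc y) x) ⟨
    ((suc x + suc y) C suc x) * h ∎
    where
    open ≡-Reasoning
    x = length ζ
    y = length ω
    h = hits v (f ∷ ω)

  -- The shuffles are sorted by the number `j` of entries of `ω` behind `e`. Before `e` nothing
  -- moves the walk; after it `∑-shuffles-below` applies to `ζ` and the last `j` entries of `ω`.
  ∑-shuffles-out : ∀ {u} e ζ ω → All (λ e → proj₁ e ≡ u) (e ∷ ζ) → Arc e →
    All Arc ω → All (λ e → proj₁ e ≢ u) ω →
    ∑ (shuffles (e ∷ ζ) ω) (hits u) ≡
    ∑ (downFrom (suc (length ω))) (λ j → ((length ζ + j) C length ζ) * hits (proj₂ e) (final j ω))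
  ∑-shuffles-out {u} e ζ [] (≡.refl ∷ ps) arc _ _ = cong (_+ 0) (≡.trans
    (cong (λ v → hits v ζ) (next-take e ≡.refl))
    (≡.trans (sym (∑-shuffles-[] ζ _)) (∑-shuffles-below ζ [] ps [] arc)))
  ∑-shuffles-out {u} e ζ (f ∷ ω) (≡.refl ∷ ps) arc (q ∷ qs) (r ∷ rs) = begin
    ∑ (shuffles (e ∷ ζ) (f ∷ ω)) (hits u)
      ≡⟨ ∑-shuffles-∷ e f ζ ω _ ⟩
    ∑ (shuffles ζ (f ∷ ω)) (hits (next u e)) + ∑ (shuffles (e ∷ ζ) ω) (hits (next u f))
      ≡⟨ cong₂ (λ v v′ → ∑ (shuffles ζ (f ∷ ω)) (hits v) + ∑ (shuffles (e ∷ ζ) ω) (hits v′))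
           (next-take e ≡.refl) (next-skip f r) ⟩
    ∑ (shuffles ζ (f ∷ ω)) (hits (proj₂ e)) + ∑ (shuffles (e ∷ ζ) ω) (hits u)
      ≡⟨ cong₂ _+_ (∑-shuffles-below ζ (f ∷ ω) ps (q ∷ qs) arc)
           (∑-shuffles-out e ζ ω (≡.refl ∷ ps) arc qs rs) ⟩
    ((length ζ + suc (length ω)) C length ζ) * hits (proj₂ e) (f ∷ ω) +
    ∑ (downFrom (suc (length ω))) (λ j → ((length ζ + j) C length ζ) * hits (proj₂ e) (final j ω))
      ≡⟨ cong₂ (λ l s → ((length ζ + suc (length ω)) C length ζ) * hits (proj₂ e) l + s)
           (sym (final-all (f ∷ ω)))
           (∑-cong-∈ (downFrom (suc (length ω))) (λ {j} m →
             cong (λ l → ((length ζ + j) C length ζ) * hits (proj₂ e) l)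
               (sym (final-∷ j f ω (≤-pred (∈-downFrom⁻ m)))))) ⟩
    ∑ (downFrom (suc (suc (length ω))))
      (λ j → ((length ζ + j) C length ζ) * hits (proj₂ e) (final j (f ∷ ω))) ∎
    where open ≡-Reasoning

  outs others : Fin n → List (Edge n) → List (Edge n)
  outs v   = filter (λ e → proj₁ e ≟ v)
  others v = filter (λ e → ¬? (proj₁ e ≟ v))

  split-outs : ∀ v U → U ↭ outs v U ++ others v U
  split-outs v []      = ↭-refl
  split-outs v (e ∷ U) with proj₁ e ≟ v
  ... | yes _ = prep e (split-outs v U)
  ... | no  _ = ↭-trans (prep e (split-outs v U)) (↭-sym (shift e (outs v U) (others v U)))

  outs-others : ∀ {u v} U → u ≢ v → outs v (others u U) ≡ outs v U
  outs-others []      u≢v = ≡.refl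
  outs-others {u} {v} (e ∷ U) u≢v with proj₁ e ≟ u
  ... | yes ≡.refl with proj₁ e ≟ v
  ...   | yes p = contradiction p u≢v
  ...   | no  _ = outs-others U u≢v
  outs-others {u} {v} (e ∷ U) u≢v | no _ with proj₁ e ≟ v
  ...   | yes _ = cong (e ∷_) (outs-others U u≢v)
  ...   | no  _ = outs-others U u≢v

  -- Descending chains and the induction claim

  data Descending : List (Fin n) → Set where
    sink : Descending [ z ]
    _∷_  : ∀ {u ws} → All (λ v → T u v ≡ true) ws → Descending ws → Descending (u ∷ ws)

  -- Speaks only of edges that leave listed vertices. So it survives deletion of the out-edges of a
  -- higher vertex, and the full edge set serves for every start vertex.
  Complete : List (Edge n) → List (Fin n) → Set
  Complete U []       = ⊤
  Complete U (v ∷ ws) = (outs v U ↭ map (v ,_) ws) × Complete U ws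

  Complete-others : ∀ {u} U ws → All (λ v → T u v ≡ true) ws → Complete U ws → Complete (others u U) ws
  Complete-others U []       []       _        = tt
  Complete-others U (v ∷ ws) (p ∷ ps) (c , cs) =
    subst (_↭ map (v ,_) ws) (sym (outs-others U (below⇒≢ p))) c , Complete-others U ws ps cs

  -- The first `t` entries are dropped, not conditioned on; out-edges of `v` among them are lost,
  -- which is how a walk can get stuck.
  successes : List (Edge n) → ℕ → Fin n → ℕ
  successes U t v = ∑ (perms U) (hits v ∘ drop t)

  -- Out of M ! orders, s are successful: for r ≥ 1 the success probability is at least
  -- 2(r² + r + 1) / 3r(r + 1) times d / M, the fraction of the stream still to come.
  Bound : (r M d s : ℕ) → Set
  Bound zero    M d s = M ! ≤ s
  Bound (suc k) M d s = 2 * (suc k * suc k + suc k + 1) * d * M ! ≤ 3 * suc k * suc (suc k) * M * s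

  Bounded : List (Fin n) → Set
  Bounded []       = ⊤
  Bounded (u ∷ ws) =
    (∀ U → All Arc U → Complete U (u ∷ ws) → ∀ t d → t + d ≡ length U →
      Bound (length ws) (length U) d (successes U t u))
    × Bounded ws

  -- ∑ 2(j² + j + 1) / 3j(j + 1) over 1 ≤ j ≤ k equals 2k(k + 2) / 3(k + 1).
  ∑-successes : ∀ {ws} k W t d → length ws ≡ suc k → Descending ws → Bounded ws →
    All Arc W → Complete W ws → t + d ≡ length W →
    (3 * suc k * length W + 2 * k * (k + 2) * d) * length W ! ≤
    3 * suc k * length W * ∑ ws (successes W t)
  ∑-successes zero W t d _ sink (b , _) arcs c eq = begin
    (3 * 1 * w + 0) * w !              ≡⟨ cong (_* w !) (+-identityʳ (3 * 1 * w)) ⟩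
    3 * 1 * w * w !                    ≤⟨ *-monoʳ-≤ (3 * 1 * w) (b W arcs c t d eq) ⟩
    3 * 1 * w * successes W t z        ≡⟨ cong (3 * 1 * w *_) (+-identityʳ _) ⟨
    3 * 1 * w * (successes W t z + 0)  ∎
    where
    open ≤-Reasoning
    w = length W
  ∑-successes zero W t d () (_ ∷ sink)
  ∑-successes zero W t d () (_ ∷ (_ ∷ _))
  ∑-successes (suc k) W t d len (_∷_ {u} {ws} _ desc) (b , bs) arcs (c , cs) eq =
    *-cancelˡ-≤ (suc k) (begin
    suc k * ((3 * suc (suc k) * w + 2 * suc k * (suc k + 2) * d) * w !)
      ≡⟨ reorder₁ k w d (w !) ⟩
    2 * (suc k * suc k + suc k + 1) * d * w ! +
    suc (suc k) * ((3 * suc k * w + 2 * k * (k + 2) * d) * w !)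
      ≤⟨ +-mono-≤
           (subst (λ r → Bound r w d (successes W t u)) (suc-injective len) (b W arcs (c , cs) t d eq))
           (*-monoʳ-≤ (suc (suc k)) (∑-successes k W t d (suc-injective len) desc bs arcs cs eq)) ⟩
    3 * suc k * suc (suc k) * w * successes W t u +
    suc (suc k) * (3 * suc k * w * ∑ ws (successes W t))
      ≡⟨ reorder₂ (suc k) w (successes W t u) _ ⟩
    suc k * (3 * suc (suc k) * w * (successes W t u + ∑ ws (successes W t))) ∎)
    where
    open ≤-Reasoning
    w = length W
    reorder₁ : ∀ k w d f → suc k * ((3 * suc (suc k) * w + 2 * suc k * (suc k + 2) * d) * f) ≡
      2 * (suc k * suc k + suc k + 1) * d * f +
      suc (suc k) * ((3 * suc k * w + 2 * k * (k + 2) * d) * f)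
    reorder₁ = solve-∀
    reorder₂ : ∀ r w s S → 3 * r * suc r * w * s + suc r * (3 * r * w * S) ≡
      r * (3 * suc r * w * (s + S))
    reorder₂ = solve-∀

  atHead-∑ : ∀ (Ω : List B) (κ : B → A → ℕ) l →
    ∑ Ω (λ ω → atHead (κ ω) l) ≡ atHead (λ x → ∑ Ω (λ ω → κ ω x)) l
  atHead-∑ Ω κ []      = ∑-zero Ω
  atHead-∑ Ω κ (x ∷ l) = ≡.refl

  -- The induction step at a vertex `u`

  module Step (u v₀ : Fin n) (vs : List (Fin n))
              (below : All (λ v → T u v ≡ true) (v₀ ∷ vs))
              (W : List (Edge n)) (arcs : All Arc W) (foreign : All (λ e → proj₁ e ≢ u) W) where

    ws = v₀ ∷ vs
    Z  = map (u ,_) ws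
    k  = length vs
    w  = length W
    -- With `j` edges of `W` to come, the success probabilities of the vertices in `ws` sum to at
    -- least 1 + 2k(k + 2) j / 3(k + 1) w, which is `(a + b * j) / a`.
    a  = 3 * suc k * w
    b  = 2 * k * (k + 2)

    length-Z : length Z ≡ suc k
    length-Z = length-map _ ws

    tails : All (λ e → proj₁ e ≡ u) Z
    tails = All.map⁺ (All.universal (λ _ → ≡.refl) ws)

    arcs-Z : All Arc Z
    arcs-Z = All.map⁺ below

    rest : ℕ × ℕ → ℕ
    rest (x , y) = ∑ (perms Z) (λ ζ → ∑ (perms W) (λ ω → ∑ (shuffles (final x ζ) (final y ω)) (hits u)))

    successes-cuts : ∀ t → successes (Z ++ W) t u ≡ ∑ (cuts t (suc k) w) rest
    successes-cuts t = begin
      successes (Z ++ W) t u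
        ≡⟨ ∑-perms-++ Z W _ ⟩
      ∑ (perms Z) (λ ζ → ∑ (perms W) (λ ω → ∑ (shuffles ζ ω) (hits u ∘ drop t)))
        ≡⟨ ∑-cong-∈ (perms Z) (λ {ζ} ζ∈ → ∑-cong-∈ (perms W) (λ {ω} ω∈ →
             ≡.trans (∑-shuffles-drop t ζ ω (hits u))
             (cong₂ (λ x y → ∑ (cuts t x y) (cut ζ ω))
               (≡.trans (↭-length (perms-↭ Z ζ∈)) length-Z) (↭-length (perms-↭ W ω∈))))) ⟩
      ∑ (perms Z) (λ ζ → ∑ (perms W) (λ ω → ∑ (cuts t (suc k) w) (cut ζ ω)))
        ≡⟨ ∑-cong (perms Z) (λ ζ → ∑-swap (perms W) (cuts t (suc k) w) (cut ζ)) ⟩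
      ∑ (perms Z) (λ ζ → ∑ (cuts t (suc k) w) (λ p → ∑ (perms W) (λ ω → cut ζ ω p)))
        ≡⟨ ∑-swap (perms Z) (cuts t (suc k) w) _ ⟩
      ∑ (cuts t (suc k) w) rest ∎
      where
      open ≡-Reasoning
      cut : List (Edge n) → List (Edge n) → ℕ × ℕ → ℕ
      cut ζ ω (x , y) = ∑ (shuffles (final x ζ) (final y ω)) (hits u)

    -- If `suc x` of the `suc k` out-edges are left, the deciding one is entry `k ∸ x` of `ζ`, and
    -- the walk goes on in `ω` after its first `w ∸ j` entries.
    shuffled-rest : ∀ x y ζ ω → ζ ↭ Z → ω ↭ W → suc x ≤ suc k → y ≤ w →
      ∑ (shuffles (final (suc x) ζ) (final y ω)) (hits u) ≡
      ∑ (downFrom (suc y)) (λ j → ((x + j) C x) *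
        atHead (λ e → hits (proj₂ e) (drop (w ∸ j) ω)) (drop (k ∸ x) ζ))
    shuffled-rest x y ζ ω ζ↭ ω↭ x≤ y≤ = go (final (suc x) ζ) ≡.refl
      where
      |ζ| : length ζ ≡ suc k
      |ζ| = ≡.trans (↭-length ζ↭) length-Z
      |ω| : length ω ≡ w
      |ω| = ↭-length ω↭
      y≤ω : y ≤ length ω
      y≤ω = ≤-trans y≤ (≤-reflexive (sym |ω|))
      len : length (final (suc x) ζ) ≡ suc x
      len = length-final (suc x) ζ (≤-trans x≤ (≤-reflexive (sym |ζ|)))
      go : ∀ l → final (suc x) ζ ≡ l → ∑ (shuffles l (final y ω)) (hits u) ≡
        ∑ (downFrom (suc y)) (λ j → ((x + j) C x) *
          atHead (λ e → hits (proj₂ e) (drop (w ∸ j) ω)) (drop (k ∸ x) ζ))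
      go [] eq with () ← ≡.trans (sym (cong length eq)) len
      go (e ∷ ζ′) eq = ≡.trans
        (∑-shuffles-out e ζ′ (final y ω)
          (subst (All _) eq (All.drop⁺ (length ζ ∸ suc x) (All-resp-↭ (↭-sym ζ↭) tails)))
          (All.head (subst (All _) eq (All.drop⁺ (length ζ ∸ suc x) (All-resp-↭ (↭-sym ζ↭) arcs-Z))))
          (All.drop⁺ (length ω ∸ y) (All-resp-↭ (↭-sym ω↭) arcs))
          (All.drop⁺ (length ω ∸ y) (All-resp-↭ (↭-sym ω↭) foreign)))
        (≡.trans (cong₂ (λ p q → ∑ (downFrom (suc q)) (λ j → ((p + j) C p) * hits (proj₂ e) (final j (final y ω))))
            (suc-injective (≡.trans (sym (cong length eq)) len)) (length-final y ω y≤ω))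
        (∑-cong-∈ (downFrom (suc y)) (λ {j} j∈ → cong (((x + j) C x) *_) (≡.trans
          (cong (hits (proj₂ e)) (≡.trans (final-final j y ω (≤-pred (∈-downFrom⁻ j∈)) y≤ω)
            (cong (λ m → drop (m ∸ j) ω) |ω|)))
          (cong (atHead _) (≡.trans (sym eq) (cong (λ m → drop (m ∸ suc x) ζ) |ζ|)))))))

    -- The deciding out-edge has a fixed position in `ζ`, so summing over `ζ` averages its head over
    -- `ws`, while summing over `ω` yields `successes W`.
    rest-average : ∀ x y → suc x ≤ suc k → y ≤ w →
      rest (suc x , y) ≡
      ∑ (downFrom (suc y)) (λ j → ((x + j) C x) * (k ! * ∑ ws (successes W (w ∸ j))))
    rest-average x y x≤ y≤ = begin
      rest (suc x , y)
        ≡⟨ ∑-cong-∈ (perms Z) (λ {ζ} ζ∈ → ∑-cong-∈ (perms W) (λ {ω} ω∈ →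
             shuffled-rest x y ζ ω (perms-↭ Z ζ∈) (perms-↭ W ω∈) x≤ y≤)) ⟩
      ∑ (perms Z) (λ ζ → ∑ (perms W) (λ ω → ∑ J (λ j → c j * atHead (κ j ω) (drop i ζ))))
        ≡⟨ ∑-cong (perms Z) (λ ζ → ≡.trans (∑-swap (perms W) J _) (∑-cong J (λ j →
             ≡.trans (∑-*ˡ (c j) (perms W) _) (cong (c j *_) (atHead-∑ (perms W) (κ j) (drop i ζ)))))) ⟩
      ∑ (perms Z) (λ ζ → ∑ J (λ j → c j * atHead (K j) (drop i ζ)))
        ≡⟨ ≡.trans (∑-swap (perms Z) J _) (∑-cong J (λ j → ∑-*ˡ (c j) (perms Z) _)) ⟩
      ∑ J (λ j → c j * ∑ (perms Z) (λ ζ → atHead (K j) (drop i ζ)))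
        ≡⟨ ∑-cong J (λ j → cong (c j *_) (≡.trans
             (∑-perms-atHead (u , v₀) (map (u ,_) vs) (K j) i x
               (≡.trans (length-map _ vs) (sym (m∸n+n≡m (≤-pred x≤)))))
             (cong₂ (λ l s → l ! * s) (length-map _ vs) (∑-map (u ,_) ws (K j))))) ⟩
      ∑ J (λ j → c j * (k ! * ∑ ws (successes W (w ∸ j)))) ∎
      where
      open ≡-Reasoning
      J = downFrom (suc y)
      i = k ∸ x
      c : ℕ → ℕ
      c j = (x + j) C x
      κ : ℕ → List (Edge n) → Edge n → ℕ
      κ j ω e = hits (proj₂ e) (drop (w ∸ j) ω)
      K : ℕ → Edge n → ℕ
      K j e = ∑ (perms W) (λ ω → κ j ω e)

    module _ (∑-bound : ∀ j → j ≤ w → (a + b * j) * w ! ≤ a * ∑ ws (successes W (w ∸ j))) where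

      gain≤rest : ∀ x y → x ≤ suc k → y ≤ w → k ! * w ! * gain a b x y ≤ a * rest (x , y)
      gain≤rest zero    y _  _  rewrite *-zeroʳ (k ! * w !) = z≤n
      gain≤rest (suc x) y x≤ y≤ = begin
        k ! * w ! * ∑ J (λ j → c j * (a + b * j))
          ≡⟨ ∑-*ˡ (k ! * w !) J _ ⟨
        ∑ J (λ j → k ! * w ! * (c j * (a + b * j)))
          ≤⟨ ∑-mono-∈ J (λ {j} j∈ → begin
               k ! * w ! * (c j * (a + b * j))    ≡⟨ reorder₁ (k !) (w !) (c j) (a + b * j) ⟩
               k ! * c j * ((a + b * j) * w !)
                 ≤⟨ *-monoʳ-≤ (k ! * c j) (∑-bound j (≤-trans (≤-pred (∈-downFrom⁻ j∈)) y≤)) ⟩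
               k ! * c j * (a * S j)              ≡⟨ reorder₂ (k !) (c j) a (S j) ⟩
               a * (c j * (k ! * S j))            ∎) ⟩
        ∑ J (λ j → a * (c j * (k ! * S j)))
          ≡⟨ ∑-*ˡ a J _ ⟩
        a * ∑ J (λ j → c j * (k ! * S j))
          ≡⟨ cong (a *_) (rest-average x y x≤ y≤) ⟨
        a * rest (suc x , y) ∎
        where
        open ≤-Reasoning
        J = downFrom (suc y)
        c S : ℕ → ℕ
        c j = (x + j) C x
        S j = ∑ ws (successes W (w ∸ j))
        reorder₁ : ∀ f g c e → f * g * (c * e) ≡ f * c * (e * g)
        reorder₁ = solve-∀
        reorder₂ : ∀ f c a s → f * c * (a * s) ≡ a * (c * (f * s))
        reorder₂ = solve-∀

      successes-gain : ∀ t →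
        k ! * w ! * ∑ (cuts t (suc k) w) (uncurry (gain a b)) ≤ a * successes (Z ++ W) t u
      successes-gain t = begin
        k ! * w ! * ∑ (cuts t (suc k) w) (uncurry (gain a b))
          ≡⟨ ∑-*ˡ (k ! * w !) (cuts t (suc k) w) _ ⟨
        ∑ (cuts t (suc k) w) (λ (x , y) → k ! * w ! * gain a b x y)
          ≤⟨ ∑-mono-∈ (cuts t (suc k) w) (λ {(x , y)} m →
               gain≤rest x y (proj₁ (cuts-≤ t _ _ m)) (proj₂ (cuts-≤ t _ _ m))) ⟩
        ∑ (cuts t (suc k) w) (λ p → a * rest p)
          ≡⟨ ∑-*ˡ a (cuts t (suc k) w) _ ⟩
        a * ∑ (cuts t (suc k) w) rest
          ≡⟨ cong (a *_) (successes-cuts t) ⟨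
        a * successes (Z ++ W) t u ∎
        where open ≤-Reasoning

      bound : ∀ t d → .{{NonZero w}} → t + d ≡ suc k + w →
        Bound (suc k) (suc k + w) d (successes (Z ++ W) t u)
      bound t d eq = *-cancelˡ-≤ w (begin
        w * (2 * (suc k * suc k + suc k + 1) * d * (suc k + w) !)
          ≡⟨ cong (λ f → w * (2 * (suc k * suc k + suc k + 1) * d * f)) (factorial-split (suc k) w) ⟩
        w * (2 * (suc k * suc k + suc k + 1) * d * (suc k ! * (w ! * ((suc k + w) C suc k))))
          ≡⟨ reorder₁ (2 * (suc k * suc k + suc k + 1)) d w (suc k) (k !) (w !) _ ⟩
        k ! * w ! * (2 * (suc k * suc k + suc k + 1) * d * w * suc k * ((suc k + w) C suc k))
          ≤⟨ *-monoʳ-≤ (k ! * w !) (gain-bound k w t d X eq (∑-cuts-gain a b t d (suc k) w eq)) ⟩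
        k ! * w ! * (suc (suc k) * (suc k + w) * X)
          ≡⟨ reorder₂ (k ! * w !) (suc (suc k) * (suc k + w)) X ⟩
        suc (suc k) * (suc k + w) * (k ! * w ! * X)
          ≤⟨ *-monoʳ-≤ (suc (suc k) * (suc k + w)) (successes-gain t) ⟩
        suc (suc k) * (suc k + w) * (a * successes (Z ++ W) t u)
          ≡⟨ reorder₃ (suc k) w (suc k + w) (successes (Z ++ W) t u) ⟩
        w * (3 * suc k * suc (suc k) * (suc k + w) * successes (Z ++ W) t u) ∎)
        where
        open ≤-Reasoning
        X = ∑ (cuts t (suc k) w) (uncurry (gain a b))
        reorder₁ : ∀ p d w r f g c → w * (p * d * (r * f * (g * c))) ≡ f * g * (p * d * w * r * c)
        reorder₁ = solve-∀
        reorder₂ : ∀ f q X → f * (q * X) ≡ q * (f * X)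
        reorder₂ = solve-∀
        reorder₃ : ∀ r w M s → suc r * M * (3 * r * w * s) ≡ w * (3 * r * suc r * M * s)
        reorder₃ = solve-∀

  ∑-successes-single : ∀ {u} U → U ↭ [ u , z ] → ∀ t d → t + d ≡ 1 →
    Bound 1 1 d (successes U t u)
  ∑-successes-single {u} U U↭ zero _ ≡.refl
    rewrite ∑-perms-↭ {U = U} (hits u) U↭
          | next-take {v = u} (u , z) ≡.refl | dec-true (z ≟ z) ≡.refl = ≤-refl
  ∑-successes-single U U↭ (suc zero) zero ≡.refl = z≤n

  -- A chain with a second vertex would require an edge, so without edges only the sink remains.
  Complete-[] : ∀ {vs} → Descending vs → Complete [] vs → vs ≡ [ z ]
  Complete-[] sink            _       = ≡.refl
  Complete-[] (_ ∷ sink)      (c , _) with () ← ↭-length c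
  Complete-[] (_ ∷ (_ ∷ _))   (c , _) with () ← ↭-length c

  bounded-∷ : ∀ {u v ws} → All (λ v → T u v ≡ true) (v ∷ ws) → Descending (v ∷ ws) → Bounded (v ∷ ws) →
    ∀ U → All Arc U → Complete U (u ∷ v ∷ ws) → ∀ t d → t + d ≡ length U →
    Bound (suc (length ws)) (length U) d (successes U t u)
  bounded-∷ {u} {v} {ws} below desc bs U arcs (c , cs) t d eq =
    go (others u U) (All.all-filter other? U) (All.filter⁺ other? arcs)
      (Complete-others U (v ∷ ws) below cs) (↭-trans (split-outs u U) (++⁺ʳ (others u U) c))
    where
    other? = λ e → ¬? (proj₁ e ≟ u)
    go : ∀ W → All (λ e → proj₁ e ≢ u) W → All Arc W → Complete W (v ∷ ws) →
      U ↭ map (u ,_) (v ∷ ws) ++ W → Bound (suc (length ws)) (length U) d (successes U t u)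
    -- The general step divides by `length W`; when `W` is empty, `U` is the single edge from `u` to
    -- `z`.
    go [] _ _ completeW U↭ with ≡.refl ← Complete-[] desc completeW =
      subst (λ M → Bound 1 M d (successes U t u)) (sym (↭-length U↭))
        (∑-successes-single U U↭ t d (≡.trans eq (↭-length U↭)))
    go W@(_ ∷ _) foreign arcsW completeW U↭ =
      ≡.subst₂ (λ M s → Bound (suc (length ws)) M d s) (sym length-U) (sym (∑-perms-↭ _ U↭))
        (Step.bound u v ws below W arcsW foreign
          (λ j j≤ → ∑-successes (length ws) W (length W ∸ j) j ≡.refl desc bs arcsW completeW
            (m∸n+n≡m j≤))
          t d (≡.trans eq length-U))
      where
      length-U : length U ≡ suc (length ws) + length W
      length-U = ≡.trans (↭-length U↭) (≡.trans (length-++ (map (u ,_) (v ∷ ws)))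
        (cong (_+ length W) (length-map _ (v ∷ ws))))

  hits-sink : ∀ U → outs z U ↭ [] → ∀ t σ → σ ↭ U → hits z (drop t σ) ≡ 1
  hits-sink U c t σ σ↭ = ≡.trans
    (cong (λ v → if does (v ≟ z) then 1 else 0) (walk-skip (drop t σ)
      (All.drop⁺ t (All-resp-↭ (↭-sym σ↭) (All.tabulate none)))))
    (cong (if_then 1 else 0) (dec-true (z ≟ z) ≡.refl))
    where
    none : ∀ {e} → e ∈ U → proj₁ e ≢ z
    none e∈ p with () ← ∈-resp-↭ c (∈-filter⁺ (λ e → proj₁ e ≟ z) e∈ p)

  bounded : ∀ {ws} → Descending ws → Bounded ws
  bounded sink = (λ U arcs (c , _) t d eq → ≤-reflexive (begin
      length U !                  ≡⟨ *-identityʳ _ ⟨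
      length U ! * 1              ≡⟨ ∑-perms-const U 1 ⟨
      ∑ (perms U) (const 1)       ≡⟨ ∑-cong-∈ (perms U) (λ {σ} σ∈ → hits-sink U c t σ (perms-↭ U σ∈)) ⟨
      successes U t z             ∎)) , tt
    where open ≡-Reasoning
  bounded (below ∷ sink)            = bounded-∷ below sink (bounded sink) , bounded sink
  bounded (below ∷ (below′ ∷ desc)) = let bs = bounded (below′ ∷ desc) in
    bounded-∷ below (below′ ∷ desc) bs , bs

  outs-nonempty : ∀ {v} U {e l} → outs v U ↭ e ∷ l → NonZero (length U)
  outs-nonempty []      c with () ← ↭-length c
  outs-nonempty (_ ∷ _) c = _

  -- At time 0 the whole stream is to come, and 2(r² + r + 1) = 2r(r + 1) + 2 leaves 2/3 after the
  -- last summand is dropped. Vertices above `v` are skipped without touching `U`.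
  two-thirds : ∀ U {v ws} → v ∈ ws → All Arc U → Complete U ws → Bounded ws →
    2 * length U ! ≤ 3 * successes U 0 v
  two-thirds U (there v∈) arcs (_ , cs) (_ , bs) = two-thirds U v∈ arcs cs bs
  two-thirds U {v} {_ ∷ []} (here ≡.refl) arcs c (b , _) = begin
    2 * length U !          ≤⟨ *-mono-≤ (n≤1+n 2) (b U arcs c 0 (length U) ≡.refl) ⟩
    3 * successes U 0 v     ∎
    where open ≤-Reasoning
  two-thirds U {v} {_ ∷ v′ ∷ ws} (here ≡.refl) arcs c@(c₀ , _) (b , _) =
    *-cancelˡ-≤ (r * suc r * M) {{m*n≢0 (r * suc r) M {{_}} {{outs-nonempty U c₀}}}} (begin
    r * suc r * M * (2 * M !)
      ≤⟨ m≤m+n _ (2 * M * M !) ⟩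
    r * suc r * M * (2 * M !) + 2 * M * M !
      ≡⟨ reorder₁ r M (M !) ⟩
    2 * (r * r + r + 1) * M * M !
      ≤⟨ b U arcs c 0 M ≡.refl ⟩
    3 * r * suc r * M * successes U 0 v
      ≡⟨ reorder₂ r M (successes U 0 v) ⟩
    r * suc r * M * (3 * successes U 0 v) ∎)
    where
    open ≤-Reasoning
    r = suc (length ws)
    M = length U
    reorder₁ : ∀ r M f → r * suc r * M * (2 * f) + 2 * M * f ≡ 2 * (r * r + r + 1) * M * f
    reorder₁ = solve-∀
    reorder₂ : ∀ r M s → 3 * r * suc r * M * s ≡ r * suc r * M * (3 * s)
    reorder₂ = solve-∀

-- Stream orders as permutations

module FirstEntry (_≟ᴬ_ : DecidableEquality A) where

  remove : A → List A → List A
  remove x = filter (λ y → ¬? (x ≟ᴬ y))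

  remove-∷ : ∀ x U → remove x (x ∷ U) ≡ remove x U
  remove-∷ x U rewrite dec-true (x ≟ᴬ x) ≡.refl = ≡.refl

  remove-≢ : ∀ {x y} U → x ≢ y → remove x (y ∷ U) ≡ y ∷ remove x U
  remove-≢ {x} {y} U x≢y rewrite dec-false (x ≟ᴬ y) x≢y = ≡.refl

  remove-head : ∀ {x U} → Unique (x ∷ U) → remove x (x ∷ U) ≡ U
  remove-head {x} {U} (x∉ ∷ _) = ≡.trans (remove-∷ x U) (filter-all (λ y → ¬? (x ≟ᴬ y)) x∉)

  length-remove : ∀ {x U} → Unique U → x ∈ U → suc (length (remove x U)) ≡ length U
  length-remove uniq (here ≡.refl) = cong (suc ∘ length) (remove-head uniq)
  length-remove {x} {y ∷ U} (y∉ ∷ uniq) (there x∈) = ≡.trans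
    (cong (suc ∘ length) (remove-≢ U (λ x≡y → All.lookup y∉ x∈ (sym x≡y))))
    (cong suc (length-remove uniq x∈))

  -- Covers the insertions of `x` anywhere but in front; the empty list offers none.
  afterHead : A → (List A → ℕ) → List A → ℕ
  afterHead x f []      = 0
  afterHead x f (y ∷ σ) = ∑ (inserts x σ) (f ∘ (y ∷_))

  ∑-inserts-afterHead : ∀ x f σ → ∑ (inserts x σ) f ≡ f (x ∷ σ) + afterHead x f σ
  ∑-inserts-afterHead x f []      = ≡.refl
  ∑-inserts-afterHead x f (y ∷ σ) = ∑-inserts-∷ x y σ f

  -- `perms` grows by insertion whereas `funs` chooses the first entry first; this brings the former
  -- into the shape of the latter. Entries are removed by value, hence `Unique`.
  ∑-perms-first : ∀ {U} → Unique U → NonZero (length U) → ∀ f →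
    ∑ (perms U) f ≡ ∑ U (λ x → ∑ (perms (remove x U)) (f ∘ (x ∷_)))
  ∑-perms-first {x ∷ U} (x∉ ∷ uniq) _ f = begin
    ∑ (perms (x ∷ U)) f
      ≡⟨ ≡.trans (∑-perms-∷ x U f) (∑-cong (perms U) (∑-inserts-afterHead x f)) ⟩
    ∑ (perms U) (λ σ → f (x ∷ σ) + afterHead x f σ)
      ≡⟨ ∑-+ (perms U) _ _ ⟩
    ∑ (perms U) (f ∘ (x ∷_)) + ∑ (perms U) (afterHead x f)
      ≡⟨ cong₂ _+_ (cong (λ V → ∑ (perms V) (f ∘ (x ∷_))) (sym (remove-head (x∉ ∷ uniq))))
           (later U x∉ uniq) ⟩
    ∑ (x ∷ U) (λ y → ∑ (perms (remove y (x ∷ U))) (f ∘ (y ∷_))) ∎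
    where
    open ≡-Reasoning
    later : ∀ U → All (x ≢_) U → Unique U →
      ∑ (perms U) (afterHead x f) ≡ ∑ U (λ y → ∑ (perms (remove y (x ∷ U))) (f ∘ (y ∷_)))
    later []        x∉ uniq = ≡.refl
    later U@(_ ∷ _) x∉ uniq = ≡.trans (∑-perms-first uniq _ (afterHead x f))
      (∑-cong-∈ U (λ {y} y∈ → sym (≡.trans
        (cong (λ V → ∑ (perms V) (f ∘ (y ∷_))) (remove-≢ U (λ y≡x → All.lookup x∉ y∈ (sym y≡x))))
        (∑-perms-∷ x (remove y U) _))))

∑-filterᵇ : ∀ (p : A → Bool) xs f → ∑ (filterᵇ p xs) f ≡ ∑ xs (λ x → if p x then f x else 0)
∑-filterᵇ p []       f = ≡.refl
∑-filterᵇ p (x ∷ xs) f with p x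
... | true  = cong (f x +_) (∑-filterᵇ p xs f)
... | false = ∑-filterᵇ p xs f

∑-funs : ∀ {m} (xs : List A) {f : (Fin (suc m) → A) → ℕ} (g : A → (Fin m → A) → ℕ) →
  (∀ s → f s ≡ g (s zero) (s ∘ suc)) →
  ∑ (funs (suc m) xs) f ≡ ∑ xs (λ x → ∑ (funs m xs) (g x))
∑-funs {m = m} xs g fg = ≡.trans (∑-concatMap _ xs _)
  (∑-cong xs (λ x → ≡.trans (∑-map _ (funs m xs) _) (∑-cong (funs m xs) (λ s → fg _))))

≡true-ext : ∀ {b c} → (b ≡ true → c ≡ true) → (c ≡ true → b ≡ true) → b ≡ c
≡true-ext {true}  {_}     f g = sym (f ≡.refl)
≡true-ext {false} {false} f g = ≡.refl
≡true-ext {false} {true}  f g = g ≡.refl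

∧-true⁻ : ∀ {b c} → b ∧ c ≡ true → b ≡ true × c ≡ true
∧-true⁻ {true} eq = ≡.refl , eq

all-allFin⁻ : ∀ {m} (q : Fin m → Bool) → all q (allFin m) ≡ true → ∀ t → q t ≡ true
all-allFin⁻ q eq = go q id eq
  where
  go : ∀ {m k} (q : Fin m → Bool) (g : Fin k → Fin m) → all q (tabulate g) ≡ true → ∀ t → q (g t) ≡ true
  go q g eq zero    = proj₁ (∧-true⁻ eq)
  go q g eq (suc t) = go q (g ∘ suc) (proj₂ (∧-true⁻ {q (g zero)} eq)) t

all-allFin⁺ : ∀ {m} (q : Fin m → Bool) → (∀ t → q t ≡ true) → all q (allFin m) ≡ true
all-allFin⁺ q h = go q id (λ t → h t)
  where
  go : ∀ {m k} (q : Fin m → Bool) (g : Fin k → Fin m) → (∀ t → q (g t) ≡ true) → all q (tabulate g) ≡ true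
  go {k = zero}  q g h = ≡.refl
  go {k = suc k} q g h = cong₂ _∧_ (h zero) (go q (g ∘ suc) (h ∘ suc))

eqEdge⁻ : ∀ {n} (e f : Edge n) → eqEdge e f ≡ true → e ≡ f
eqEdge⁻ (a , b) (c , d) eq with a ≟ c | b ≟ d
... | yes ≡.refl | yes ≡.refl = ≡.refl

eqEdge-refl : ∀ {n} (e : Edge n) → eqEdge e e ≡ true
eqEdge-refl (a , b) = cong₂ _∧_ (dec-true (a ≟ a) ≡.refl) (dec-true (b ≟ b) ≡.refl)

not-eqEdge⁻ : ∀ {n} (e f : Edge n) → not (eqEdge e f) ≡ true → e ≢ f
not-eqEdge⁻ e _ q ≡.refl = contradiction (≡.trans (sym q) (cong not (eqEdge-refl e))) λ ()

_≟ᴱ_ : ∀ {n} → DecidableEquality (Edge n)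
e ≟ᴱ f = map′ (eqEdge⁻ e f ∘ Equivalence.to T-≡)
  (λ { ≡.refl → Equivalence.from T-≡ (eqEdge-refl e) }) (T? (eqEdge e f))

module _ {n : ℕ} where
  open FirstEntry (_≟ᴱ_ {n})

  -- The test `isStreamOrder` for an arbitrary edge predicate, so that an induction along the stream
  -- can strike out each edge once it has been used.
  arrangement : ∀ {m} → (Edge n → Bool) → (Fin m → Edge n) → Bool
  arrangement {m} p s =
    all (λ t → p (s t)) (allFin m) ∧
    all (λ t → all (λ t′ → not (eqEdge (s t) (s t′)) ∨ does (t ≟ t′)) (allFin m)) (allFin m)

  Arrangement : ∀ {m} → (Edge n → Bool) → (Fin m → Edge n) → Set
  Arrangement p s = (∀ t → p (s t) ≡ true) × (∀ t t′ → s t ≡ s t′ → t ≡ t′)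

  arrangement⁻ : ∀ {m} p (s : Fin m → Edge n) → arrangement p s ≡ true → Arrangement p s
  arrangement⁻ p s eq with ∧-true⁻ {all (λ t → p (s t)) (allFin _)} eq
  ... | ps , inj = all-allFin⁻ _ ps , λ t t′ → distinct t t′ (all-allFin⁻ _ (all-allFin⁻ _ inj t) t′)
    where
    distinct : ∀ t t′ → not (eqEdge (s t) (s t′)) ∨ does (t ≟ t′) ≡ true → s t ≡ s t′ → t ≡ t′
    distinct t t′ eq st with t ≟ t′
    ... | yes t≡t′ = t≡t′
    ... | no  _ = contradiction st (not-eqEdge⁻ _ _ (≡.trans (sym (∨-identityʳ _)) eq))

  arrangement⁺ : ∀ {m} p (s : Fin m → Edge n) → Arrangement p s → arrangement p s ≡ true
  arrangement⁺ p s (ps , inj) = cong₂ _∧_ (all-allFin⁺ _ ps)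
    (all-allFin⁺ _ (λ t → all-allFin⁺ _ (λ t′ → distinct t t′)))
    where
    distinct : ∀ t t′ → not (eqEdge (s t) (s t′)) ∨ does (t ≟ t′) ≡ true
    distinct t t′ with eqEdge (s t) (s t′) in eq
    ... | false = ≡.refl
    ... | true  = dec-true (t ≟ t′) (inj t t′ (eqEdge⁻ _ _ eq))

  _without_ : (Edge n → Bool) → Edge n → Edge n → Bool
  (p without x) e = p e ∧ not (eqEdge x e)

  arrangement-suc : ∀ {m} p (s : Fin (suc m) → Edge n) →
    arrangement p s ≡ p (s zero) ∧ arrangement (p without s zero) (s ∘ suc)
  arrangement-suc p s = ≡true-ext to from
    where
    to : arrangement p s ≡ true → p (s zero) ∧ arrangement (p without s zero) (s ∘ suc) ≡ true
    to eq with arrangement⁻ p s eq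
    ... | ps , inj = cong₂ _∧_ (ps zero) (arrangement⁺ (p without s zero) (s ∘ suc)
      ((λ t → cong₂ _∧_ (ps (suc t)) (fresh t)) , λ t t′ e → Fin.suc-injective (inj _ _ e)))
      where
      fresh : ∀ t → not (eqEdge (s zero) (s (suc t))) ≡ true
      fresh t with eqEdge (s zero) (s (suc t)) in e
      ... | false = ≡.refl
      ... | true  with () ← inj zero (suc t) (eqEdge⁻ _ _ e)
    from : p (s zero) ∧ arrangement (p without s zero) (s ∘ suc) ≡ true → arrangement p s ≡ true
    from eq with ∧-true⁻ {p (s zero)} eq
    ... | p₀ , eq′ with arrangement⁻ (p without s zero) (s ∘ suc) eq′
    ... | ps , inj = arrangement⁺ p s (all-p , all-inj)
      where
      all-p : ∀ t → p (s t) ≡ true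
      all-p zero    = p₀
      all-p (suc t) = proj₁ (∧-true⁻ {p (s (suc t))} (ps t))
      fresh : ∀ t → s zero ≢ s (suc t)
      fresh t = not-eqEdge⁻ _ _ (proj₂ (∧-true⁻ {p (s (suc t))} (ps t)))
      all-inj : ∀ t t′ → s t ≡ s t′ → t ≡ t′
      all-inj zero    zero     e = ≡.refl
      all-inj zero    (suc t′) e = contradiction e (fresh t′)
      all-inj (suc t) zero     e = contradiction (sym e) (fresh t)
      all-inj (suc t) (suc t′) e = cong suc (inj t t′ e)

  filterᵇ-without : ∀ p x xs → filterᵇ (p without x) xs ≡ remove x (filterᵇ p xs)
  filterᵇ-without p x []       = ≡.refl
  filterᵇ-without p x (e ∷ xs) with p e
  ... | false = filterᵇ-without p x xs
  ... | true with eqEdge x e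
  ...   | true  = filterᵇ-without p x xs
  ...   | false = cong (e ∷_) (filterᵇ-without p x xs)

  -- Both sides choose a first edge `x` satisfying `p` and continue with `p without x`, respectively
  -- with `x` removed.
  ∑-arrangements : ∀ m p {xs} f → Unique xs → length (filterᵇ p xs) ≡ m →
    ∑ (filterᵇ (arrangement p) (funs m xs)) (f ∘ tabulate) ≡ ∑ (perms (filterᵇ p xs)) f
  ∑-arrangements zero p {xs} f uniq len with filterᵇ p xs
  ... | [] = ≡.refl
  ∑-arrangements (suc m) p {xs} f uniq len = begin
    ∑ (filterᵇ (arrangement p) (funs (suc m) xs)) (f ∘ tabulate)
      ≡⟨ ∑-filterᵇ (arrangement p) (funs (suc m) xs) _ ⟩
    ∑ (funs (suc m) xs) (λ s → if arrangement p s then f (tabulate s) else 0)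
      ≡⟨ ∑-funs xs (λ x s → if p x ∧ arrangement (p without x) s then f (x ∷ tabulate s) else 0)
           (λ s → cong (if_then f (tabulate s) else 0) (arrangement-suc p s)) ⟩
    ∑ xs (λ x → ∑ (funs m xs) (λ s → if p x ∧ arrangement (p without x) s then f (x ∷ tabulate s) else 0))
      ≡⟨ ∑-cong xs split ⟩
    ∑ xs (λ x → if p x then ∑ (filterᵇ (arrangement (p without x)) (funs m xs)) (f ∘ (x ∷_) ∘ tabulate) else 0)
      ≡⟨ ∑-filterᵇ p xs _ ⟨
    ∑ U (λ x → ∑ (filterᵇ (arrangement (p without x)) (funs m xs)) (f ∘ (x ∷_) ∘ tabulate))
      ≡⟨ ∑-cong-∈ U (λ {x} x∈ → ≡.trans
           (∑-arrangements m (p without x) (f ∘ (x ∷_)) uniq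
             (≡.trans (cong length (filterᵇ-without p x xs))
               (suc-injective (≡.trans (length-remove uniqU x∈) len))))
           (cong (λ V → ∑ (perms V) (f ∘ (x ∷_))) (filterᵇ-without p x xs))) ⟩
    ∑ U (λ x → ∑ (perms (remove x U)) (f ∘ (x ∷_)))
      ≡⟨ ∑-perms-first uniqU (subst NonZero (sym len) _) f ⟨
    ∑ (perms U) f ∎
    where
    open ≡-Reasoning
    U = filterᵇ p xs
    uniqU : Unique U
    uniqU = Unique.filter⁺ (T? ∘ p) uniq
    split : ∀ x → ∑ (funs m xs) (λ s → if p x ∧ arrangement (p without x) s then f (x ∷ tabulate s) else 0)
      ≡ (if p x then ∑ (filterᵇ (arrangement (p without x)) (funs m xs)) (f ∘ (x ∷_) ∘ tabulate) else 0)
    split x with p x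
    ... | true  = sym (∑-filterᵇ (arrangement (p without x)) (funs m xs) _)
    ... | false = ∑-zero (funs m xs)

-- The algorithm

module Transitive {n : ℕ} {T : Digraph n} (tournament : IsTournament T) (acyclic : Acyclic T) where
  open IsTournament tournament

  irreflexive : ∀ u → T u u ≢ true
  irreflexive u uu with () ← ≡.trans (sym (irrefl u)) uu

  -- Totality leaves the edge from `w` to `u` as the only alternative, and that closes a 3-cycle.
  transitive : ∀ {u v w} → T u v ≡ true → T v w ≡ true → T u w ≡ true
  transitive {u} {v} {w} uv vw with u ≟ w
  ... | yes ≡.refl with () ← ≡.trans (sym (asym u v uv)) vw
  ... | no  u≢w with total u w u≢w
  ...   | inj₁ uw = uw
  ...   | inj₂ wu = ⊥-elim (acyclic 2 (lookup (u ∷ v ∷ w ∷ []))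
                      (λ { zero → uv ; (suc zero) → vw }) wu)

  _⇒_ : Fin n → Fin n → Set
  u ⇒ v = T u v ≡ true

  insert : Fin n → List (Fin n) → List (Fin n)
  insert v []       = [ v ]
  insert v (w ∷ ws) = if T v w then v ∷ w ∷ ws else w ∷ insert v ws

  insert-↭ : ∀ v ws → insert v ws ↭ v ∷ ws
  insert-↭ v []       = ↭-refl
  insert-↭ v (w ∷ ws) with T v w
  ... | true  = ↭-refl
  ... | false = ↭-trans (prep w (insert-↭ v ws)) (swap w v ↭-refl)

  insert-⇒ : ∀ v ws → All (v ≢_) ws → AllPairs _⇒_ ws → AllPairs _⇒_ (insert v ws)
  insert-⇒ v []       _            _ = [] ∷ []
  insert-⇒ v (w ∷ ws) (v≢w ∷ v∉) (w⇒ ∷ sorted) with T v w in vw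
  ... | true  = (vw ∷ All.map (transitive vw) w⇒) ∷ w⇒ ∷ sorted
  ... | false with total v w v≢w
  ...   | inj₁ vw′ with () ← ≡.trans (sym vw) vw′
  ...   | inj₂ wv = All-resp-↭ (↭-sym (insert-↭ v ws)) (wv ∷ w⇒) ∷ insert-⇒ v ws v∉ sorted

  sort : ∀ vs → Unique vs → ∃ λ ws → ws ↭ vs × AllPairs _⇒_ ws
  sort []       _            = [] , ↭-refl , []
  sort (v ∷ vs) (v∉ ∷ uniq) with sort vs uniq
  ... | ws , ws↭ , sorted = insert v ws , ↭-trans (insert-↭ v ws) (prep v ws↭)
                          , insert-⇒ v ws (All-resp-↭ (↭-sym ws↭) v∉) sorted

  module _ (z : Fin n) where
    open Walk T irreflexive transitive z public

  lastVertex : ∀ v ws → AllPairs _⇒_ (v ∷ ws) →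
    ∃ λ z → Descending z (v ∷ ws) × z ∈ v ∷ ws × (∀ {u} → u ∈ v ∷ ws → T z u ≡ false)
  lastVertex v []       _            = v , sink , here ≡.refl , λ { (here ≡.refl) → irrefl v }
  lastVertex v (w ∷ ws) (v⇒ ∷ sorted) with lastVertex w ws sorted
  ... | z , desc , z∈ , minimal = z , v⇒ ∷ desc , there z∈ ,
        λ { (here ≡.refl) → asym v z (All.lookup v⇒ z∈) ; (there u∈) → minimal u∈ }

  -- The edge set of the tournament

  edges : List (Edge n)
  edges = filterᵇ (λ e → T (proj₁ e) (proj₂ e)) (allPairs n)

  allPairs≡ : ∀ (us vs : List (Fin n)) → concatMap (λ u → map (u ,_) vs) us ≡ cartesianProduct us vs
  allPairs≡ []       vs = ≡.refl
  allPairs≡ (u ∷ us) vs = cong (map (u ,_) vs ++_) (allPairs≡ us vs)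

  unique-allPairs : Unique (allPairs n)
  unique-allPairs = subst Unique (sym (allPairs≡ (allFin n) (allFin n)))
    (Unique.cartesianProduct⁺ (Unique.allFin⁺ n) (Unique.allFin⁺ n))

  ∈-edges⁺ : ∀ {u v} → u ⇒ v → (u , v) ∈ edges
  ∈-edges⁺ {u} {v} uv = ∈-filter⁺ (T? ∘ _)
    (subst ((u , v) ∈_) (sym (allPairs≡ (allFin n) (allFin n))) (∈-cartesianProduct⁺ (∈-allFin u) (∈-allFin v)))
    (Equivalence.from T-≡ uv)

  ∈-edges⁻ : ∀ {e} → e ∈ edges → proj₁ e ⇒ proj₂ e
  ∈-edges⁻ e∈ = Equivalence.to T-≡ (proj₂ (∈-filter⁻ (T? ∘ λ e → T (proj₁ e) (proj₂ e)) {xs = allPairs n} e∈))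

  -- Duplicate-free lists with the same members are permutations of each other. `closed` passes to
  -- the tail because an edge back up to `v` would give a loop by transitivity.
  Complete-edges : ∀ z ws → AllPairs _⇒_ ws → (∀ {v u} → v ∈ ws → v ⇒ u → u ∈ ws) → Complete z edges ws
  Complete-edges z []       _             _      = tt
  Complete-edges z (v ∷ ws) (v⇒ ∷ sorted) closed =
    ∼bag⇒↭ (unique∧set⇒bag
      (Unique.filter⁺ (λ e → proj₁ e ≟ v) (Unique.filter⁺ (T? ∘ _) unique-allPairs))
      (Unique.map⁺ ,-injectiveʳ (AllPairs.map (below⇒≢ z) sorted))
      (mk⇔ to from))
    , Complete-edges z ws sorted closed′
    where
    to : ∀ {e} → e ∈ outs z v edges → e ∈ map (v ,_) ws
    to {_ , u} e∈ with ∈-filter⁻ (λ e → proj₁ e ≟ v) {xs = edges} e∈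
    ... | e∈′ , ≡.refl with closed (here ≡.refl) (∈-edges⁻ e∈′)
    ...   | here ≡.refl = contradiction (∈-edges⁻ e∈′) (irreflexive v)
    ...   | there u∈    = ∈-map⁺ (v ,_) u∈
    from : ∀ {e} → e ∈ map (v ,_) ws → e ∈ outs z v edges
    from e∈ with ∈-map⁻ (v ,_) e∈
    ... | u , u∈ , ≡.refl = ∈-filter⁺ (λ e → proj₁ e ≟ v) (∈-edges⁺ (All.lookup v⇒ u∈)) ≡.refl
    closed′ : ∀ {v′ u} → v′ ∈ ws → v′ ⇒ u → u ∈ ws
    closed′ v′∈ v′u with closed (there v′∈) v′u
    ... | here ≡.refl = contradiction (transitive (All.lookup v⇒ v′∈) v′u) (irreflexive v)
    ... | there u∈    = u∈

  successes-bound : ∀ v → ∃ λ z → isSink T z ≡ true × 2 * length edges ! ≤ 3 * successes z edges 0 v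
  successes-bound v with sort (allFin n) (Unique.allFin⁺ n)
  ... | [] , ws↭ , _ with () ← ∈-resp-↭ (↭-sym ws↭) (∈-allFin v)
  ... | w ∷ ws , ws↭ , sorted with lastVertex w ws sorted
  ...   | z , desc , _ , minimal = z
        , all-allFin⁺ _ (λ u → cong not (minimal (every u)))
        , two-thirds z edges (every v) (All.tabulate ∈-edges⁻)
            (Complete-edges z (w ∷ ws) sorted (λ _ _ → every _)) (bounded z desc)
    where
    every : ∀ u → u ∈ w ∷ ws
    every u = ∈-resp-↭ (↭-sym ws↭) (∈-allFin u)

-- The walk in logarithmic memory

1+n≤2^ : ∀ n → suc n ≤ 2 ^ suc ⌊log₂ suc n ⌋
1+n≤2^ n with ≤-total (suc n) (2 ^ suc ⌊log₂ suc n ⌋)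
... | inj₁ h = h
... | inj₂ h = contradiction
  (≤-trans (≤-reflexive (sym (⌊log₂[2^n]⌋≡n (suc ⌊log₂ suc n ⌋)))) (⌊log₂⌋-mono-≤ h)) (n≮n _)

-- Memory may have more states than there are vertices; the surplus ones decode to `zero`, and no
-- run from `init` reaches them.
decode : ∀ {n m} → Fin m → Fin (suc n)
decode {n} q with toℕ q <? suc n
... | yes q< = fromℕ< q<
... | no  _  = zero

decode-inject≤ : ∀ {n m} (v : Fin (suc n)) (le : suc n ≤ m) → decode (inject≤ v le) ≡ v
decode-inject≤ {n} v le with toℕ (inject≤ v le) <? suc n
... | yes q< = ≡.trans (fromℕ<-cong _ _ (toℕ-inject≤ v le) q< (toℕ<n v)) (fromℕ<-toℕ v (toℕ<n v))
... | no  q≮ = contradiction (subst (_< suc n) (sym (toℕ-inject≤ v le)) (toℕ<n v)) q≮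

follow : (n : ℕ) → StreamAlg (suc n)
follow n = record
  { space = suc ⌊log₂ suc n ⌋
  -- A single coin value: the algorithm is deterministic.
  ; coins = 0
  ; init  = encode zero
  ; step  = λ _ e q → encode (next (decode q) e)
  ; out   = decode
  }
  where
  encode : Fin (suc n) → Fin (2 ^ suc ⌊log₂ suc n ⌋)
  encode v = inject≤ v (1+n≤2^ n)

module _ {n : ℕ} {T : Digraph (suc n)} (tournament : IsTournament T) (acyclic : Acyclic T) where
  open Transitive tournament acyclic

  run-follow : ∀ m (s : Fin m → Edge (suc n)) ρ q →
    decode (run (follow n) m s ρ q) ≡ walk (decode q) (tabulate s)
  run-follow zero    s ρ q = ≡.refl
  run-follow (suc m) s ρ q = ≡.trans (run-follow m (s ∘ suc) (ρ ∘ suc) _)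
    (cong (λ v → walk v (tabulate (s ∘ suc))) (decode-inject≤ (next (decode q) (s zero)) (1+n≤2^ n)))

  output-follow : ∀ {m} (s : Fin m → Edge (suc n)) ρ →
    output (follow n) s ρ ≡ walk zero (tabulate s)
  output-follow s ρ = ≡.trans (run-follow _ s ρ _)
    (cong (λ v → walk v (tabulate s)) (decode-inject≤ zero (1+n≤2^ n)))

  failed : (Fin (edgeCount T) → Edge (suc n)) → ℕ
  failed s = length (filterᵇ (λ ρ → not (isSink T (output (follow n) s ρ))) (coinSeqs (follow n) (edgeCount T)))

  -- The output does not depend on the coins: if the walk hits `z`, no coin sequence fails;
  -- otherwise at most all of them do.
  failed-bound : ∀ z → isSink T z ≡ true → ∀ s →
    failed s + length (coinSeqs (follow n) (edgeCount T)) * hits z zero (tabulate s) ≤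
    length (coinSeqs (follow n) (edgeCount T))
  failed-bound z z-sink s with walk zero (tabulate s) ≟ z
  ... | no  _ = ≤-trans (≤-reflexive (≡.trans (cong (failed s +_) (*-zeroʳ (length ρs))) (+-identityʳ _)))
                  (length-filter _ ρs)
    where ρs = coinSeqs (follow n) (edgeCount T)
  ... | yes hit = ≤-reflexive
      (cong₂ _+_ (cong length (filter-none _ (All.universal reached ρs))) (*-identityʳ (length ρs)))
    where
    ρs = coinSeqs (follow n) (edgeCount T)
    reached : ∀ ρ → ¬ _
    reached ρ t with () ← ≡.trans (sym (Equivalence.to T-≡ t))
      (cong not (≡.trans (cong (isSink T) (≡.trans (output-follow s ρ) hit)) z-sink))

  -- `total` bounds failures and hits together by all outcomes, and hits make up at least two thirds
  -- of the orders; cancelling `3 * (L * H)` leaves a third for the failures.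
  failures-bound : 3 * failures (follow n) T ≤ outcomes (follow n) T
  failures-bound with successes-bound zero
  ... | z , z-sink , bound = +-cancelʳ-≤ (3 * (L * H)) _ _ (begin
      3 * F + 3 * (L * H)               ≡⟨ *-distribˡ-+ 3 F (L * H) ⟨
      3 * (F + L * H)                   ≤⟨ *-monoʳ-≤ 3 total ⟩
      3 * (O * L)                       ≡⟨ reorder₁ O L ⟩
      O * L + L * (2 * O)               ≤⟨ +-monoʳ-≤ (O * L) (*-monoʳ-≤ L two≤three) ⟩
      O * L + L * (3 * H)               ≡⟨ cong (O * L +_) (reorder₂ L H) ⟩
      O * L + 3 * (L * H)               ∎)
    where
    open ≤-Reasoning
    orders = streamOrders T
    O = length orders
    L = length (coinSeqs (follow n) (edgeCount T))
    F = failures (follow n) T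
    H = ∑ orders (hits z zero ∘ tabulate)
    arranged : ∀ f → ∑ orders (f ∘ tabulate) ≡ ∑ (perms edges) f
    arranged f = ∑-arrangements (edgeCount T) (λ e → T (proj₁ e) (proj₂ e)) f unique-allPairs ≡.refl
    count : length edges ! ≡ O
    count = ≡.trans (≡.trans (sym (*-identityʳ _)) (sym (∑-perms-const edges 1)))
      (≡.trans (sym (arranged (const 1))) (≡.trans (∑-const orders 1) (*-identityʳ O)))
    two≤three : 2 * O ≤ 3 * H
    two≤three = ≡.subst₂ (λ o h → 2 * o ≤ 3 * h) count (sym (arranged (hits z zero))) bound
    total : F + L * H ≤ O * L
    total = begin
      F + L * H                                               ≡⟨ cong (F +_) (∑-*ˡ L orders _) ⟨
      ∑ orders failed + ∑ orders (λ s → L * hits z zero (tabulate s)) ≡⟨ ∑-+ orders _ _ ⟨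
      ∑ orders (λ s → failed s + L * hits z zero (tabulate s))
        ≤⟨ ∑-mono-∈ orders (λ {s} _ → failed-bound z z-sink s) ⟩
      ∑ orders (const L)                                      ≡⟨ ∑-const orders L ⟩
      O * L                                                   ∎
    reorder₁ : ∀ O L → 3 * (O * L) ≡ O * L + L * (2 * O)
    reorder₁ = solve-∀
    reorder₂ : ∀ L H → L * (3 * H) ≡ 3 * (L * H)
    reorder₂ = solve-∀

theorem4p4 : Σ ((n : ℕ) → StreamAlg (suc n)) (λ A →
    PolylogSpace A ×
    (∀ (n : ℕ) (T : Digraph (suc n)) → IsTournament T → Acyclic T →
    3 * failures (A n) T ≤ outcomes (A n) T))
theorem4p4 = follow , (1 , 1 , λ n → ≤-reflexive (one (suc ⌊log₂ suc n ⌋))) ,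
    λ n T tournament acyclic → failures-bound tournament acyclic
  where
  one : ∀ l → l ≡ 1 * l ^ 1
  one l = sym (≡.trans (*-identityˡ _) (*-identityʳ l))
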